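{- Let $m\ge 0$ and let $G$ be a $2$-connected graph on $3m+2$ vertices with no cycle of length congruent to $0$ or $1$ modulo $3$. Then (1) $i(G)=m+1$; (2) no minimum independent dominating set of $G$ contains an admissible pair; (3) $i(G-x)\ge i(G)$ for every $x\in V(G)$. Moreover, for every $x\in V(G)$ there is a minimum independent dominating set of $G$ containing $x$.
   Context: Graphs are finite and simple; here a graph is $2$-connected if it is $K_2$, or it has at least $3$ vertices and no vertex whose removal disconnects it. A graph is called $(0,1)$-ternary if it has no cycle of length (number of edges) congruent to $0$ or $1$ modulo $3$. $i(G)$ is the minimum size of an independent dominating set (an independent set $A$ such that every vertex is in $A$ or adjacent to a vertex of $A$). For a $2$-connected $(0,1)$-ternary graph $G$, a pair $\{u,v\}\subseteq V(G)$ is admissible if one can obtain a $2$-connected $(0,1)$-ternary graph from $G$ by attaching an ear (a path with new internal vertices) whose endpoints are exactly $u$ and $v$. -}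

module Defs where

open import Data.Nat using (ℕ; zero; suc; _+_; _*_; _≤_; _≡ᵇ_; _%_)
open import Data.Bool using (Bool; true; false; T; _∧_; _∨_; not)
open import Data.Bool.Properties using (∨-comm)
open import Data.Fin using (Fin; zero; suc; toℕ; inject₁; fromℕ; punchIn; splitAt; _≟_)
open import Data.Fin.Subset using (Subset; _∈_; ∣_∣)
open import Data.Sum using (_⊎_; inj₁; inj₂)
open import Data.Product using (Σ; ∃; ∃-syntax; _×_; _,_)
open import Data.Empty using (⊥)
open import Function.Definitions using (Injective)
open import Relation.Nullary using (¬_; yes; no)
open import Relation.Nullary.Decidable using (⌊_⌋)
open import Relation.Binary.PropositionalEquality using (_≡_; _≢_; refl; sym)

record SimpleGraph (n : ℕ) : Set where
  field
    adj    : Fin n → Fin n → Bool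
    adj-sym    : ∀ u v → adj u v ≡ adj v u
    adj-irrefl : ∀ u → adj u u ≡ false
open SimpleGraph public

Adj : ∀ {n} → SimpleGraph n → Fin n → Fin n → Set
Adj G u v = T (adj G u v)

private
  ≟-sym : ∀ {n} (x y : Fin n) → ⌊ x ≟ y ⌋ ≡ ⌊ y ≟ x ⌋
  ≟-sym x y with x ≟ y | y ≟ x
  ... | yes _ | yes _ = refl
  ... | no _  | no _  = refl
  ... | yes p | no q with q (sym p)
  ... | ()
  ≟-sym x y | no p | yes q with p (sym q)
  ... | ()

  ≟-refl : ∀ {n} (x : Fin n) → ⌊ x ≟ x ⌋ ≡ true
  ≟-refl x with x ≟ x
  ... | yes _ = refl
  ... | no p with p refl
  ... | ()

fromRel : ∀ {n} → (Fin n → Fin n → Bool) → SimpleGraph n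
fromRel {n} E = record { adj = a ; adj-sym = s ; adj-irrefl = i }
  where
  a : Fin n → Fin n → Bool
  a x y = not ⌊ x ≟ y ⌋ ∧ (E x y ∨ E y x)
  s : ∀ u v → a u v ≡ a v u
  s u v rewrite ≟-sym u v | ∨-comm (E u v) (E v u) = refl
  i : ∀ u → a u u ≡ false
  i u rewrite ≟-refl u = refl

_─_ : ∀ {n} → SimpleGraph n → Fin n → SimpleGraph (Data.Nat.pred n)
_─_ {suc n} G x = record
  { adj    = λ u v → adj G (punchIn x u) (punchIn x v)
  ; adj-sym    = λ u v → adj-sym G (punchIn x u) (punchIn x v)
  ; adj-irrefl = λ u → adj-irrefl G (punchIn x u)
  }

data Reachable {n} (G : SimpleGraph n) : Fin n → Fin n → Set where
  here : ∀ {u} → Reachable G u u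
  step : ∀ {u w v} → Adj G u w → Reachable G w v → Reachable G u v

Connected : ∀ {n} → SimpleGraph n → Set
Connected {n} G = ∀ (u v : Fin n) → Reachable G u v

TwoConnected : ∀ {n} → SimpleGraph n → Set
TwoConnected {n} G =
    (n ≡ 2 × (∀ u v → u ≢ v → Adj G u v))
  ⊎ (3 ≤ n × Connected G × (∀ x → Connected (G ─ x)))

record Cycle {n} (G : SimpleGraph n) (len : ℕ) : Set where
  field
    k      : ℕ
    len≡   : len ≡ suc k
    long   : 3 ≤ len
    verts  : Fin (suc k) → Fin n
    inj    : Injective _≡_ _≡_ verts
    steps  : ∀ (i : Fin k) → Adj G (verts (inject₁ i)) (verts (suc i))
    close  : Adj G (verts (fromℕ k)) (verts zero)

Ternary01 : ∀ {n} → SimpleGraph n → Set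
Ternary01 G = ∀ len → Cycle G len → ¬ (len % 3 ≡ 0 ⊎ len % 3 ≡ 1)

Independent : ∀ {n} → SimpleGraph n → Subset n → Set
Independent G A = ∀ u v → u ∈ A → v ∈ A → ¬ Adj G u v

Dominating : ∀ {n} → SimpleGraph n → Subset n → Set
Dominating G A = ∀ v → v ∈ A ⊎ (∃[ u ] (u ∈ A × Adj G u v))

IndDom : ∀ {n} → SimpleGraph n → Subset n → Set
IndDom G A = Independent G A × Dominating G A

MinIndDom : ∀ {n} → SimpleGraph n → Subset n → Set
MinIndDom G A = IndDom G A × (∀ B → IndDom G B → ∣ A ∣ ≤ ∣ B ∣)

IndDomNumber : ∀ {n} → SimpleGraph n → ℕ → Set
IndDomNumber G k = (∃[ A ] (IndDom G A × ∣ A ∣ ≡ k)) × (∀ B → IndDom G B → k ≤ ∣ B ∣)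

-- Attaching an ear with endpoints u, v and t new internal vertices
-- (so the ear is a path with t + 1 edges: u - w₀ - … - w_{t-1} - v,
-- or the single edge uv when t = 0). New vertices are Fin (n + t)
-- indices n, …, n + t - 1 (via splitAt).

earRel : ∀ {n} → SimpleGraph n → Fin n → Fin n → (t : ℕ)
       → Fin (n + t) → Fin (n + t) → Bool
earRel {n} G u v t x y with splitAt n x | splitAt n y
... | inj₁ a | inj₁ b = adj G a b ∨ ((t ≡ᵇ 0) ∧ ⌊ a ≟ u ⌋ ∧ ⌊ b ≟ v ⌋)
... | inj₁ a | inj₂ j = (⌊ a ≟ u ⌋ ∧ (toℕ j ≡ᵇ 0)) ∨ (⌊ a ≟ v ⌋ ∧ (suc (toℕ j) ≡ᵇ t))
... | inj₂ i | inj₁ b = false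
... | inj₂ i | inj₂ j = suc (toℕ i) ≡ᵇ toℕ j

attachEar : ∀ {n} → SimpleGraph n → Fin n → Fin n → (t : ℕ) → SimpleGraph (n + t)
attachEar G u v t = fromRel (earRel G u v t)

-- {u,v} is admissible: u ≠ v and some ear with endpoints exactly u, v
-- (with t new internal vertices; a one-edge ear is only allowed when
-- uv is not already an edge, since graphs are simple) yields a
-- 2-connected (0,1)-ternary graph.
Admissible : ∀ {n} → SimpleGraph n → Fin n → Fin n → Set
Admissible G u v =
  u ≢ v × ∃[ t ] (¬ (t ≡ 0 × Adj G u v)
                  × TwoConnected (attachEar G u v t)
                  × Ternary01 (attachEar G u v t))

ContainsAdmissiblePair : ∀ {n} → SimpleGraph n → Subset n → Set
ContainsAdmissiblePair G A = ∃[ u ] ∃[ v ] (u ∈ A × v ∈ A × Admissible G u v)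

{-# OPTIONS --safe #-}

-- Fix an edge uv.  Since all cycles have length 2 mod 3, G has no K₄ minor: in a subdivision of K₄ the
-- four triangles force the total length to be 1 mod 3, the three quadrilaterals force it to be 0.
-- Hence, by Menger's theorem, G decomposes with respect to u and v into series and parallel
-- compositions, where every network in a parallel composition is a chain of 1 mod 3 networks.
-- As far as dominating sets are concerned, a network with 3m interior vertices then behaves like an
-- edge with an offset m: m interior vertices are needed, with equality possible when at most one
-- terminal is chosen, and m + 1 are needed if neither terminal is chosen but one of them is to be
-- dominated from the inside.  An edge at x gives the bounds on i(G) and i(G - x) and a minimum set
-- through x; an admissible pair p, q is itself a pair of terminals, so that a dominating set
-- containing both has at least m + 2 elements.

module Submission where

open import Defs
open import Data.Bool using (T; true; false)
open import Data.Bool.Properties using (T?)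
open import Data.Empty using (⊥; ⊥-elim)
open import Data.Fin using (Fin; zero; suc; inject₁; fromℕ; _≟_; punchIn; punchOut; splitAt; _↑ˡ_; _↑ʳ_)
open import Data.Fin.Properties
  using (any?; splitAt-↑ˡ; splitAt-↑ʳ; splitAt⁻¹-↑ˡ; splitAt⁻¹-↑ʳ; punchIn-punchOut; punchInᵢ≢i; ↑ˡ-injective)
open import Data.Fin.Subset
  using (Subset; inside; outside; _∈_; _∉_; _⊆_; _⊂_; _⊃_; _∪_; _∩_; ⁅_⁆; ∣_∣; Empty; Nonempty)
  renaming (⊥ to ∅; ⊤ to full)
open import Data.Fin.Subset.Induction using (⊂-wellFounded; ⊃-wellFounded)
open import Data.Fin.Subset.Properties
open import Data.Integer as ℤ using (ℤ) renaming (+_ to pos)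
import Data.Integer.Divisibility.Signed as ℤ∣
import Data.Integer.Properties as ℤ
import Data.Integer.Tactic.RingSolver as ℤ-Solver
open import Data.Nat
  using (ℕ; zero; suc; pred; _+_; _*_; _≤_; s≤s; z≤n; s≤s⁻¹; _%_; _/_; _≤?_; _≡ᵇ_)
open import Data.Nat.DivMod using (m%n<n; m≡m%n+[m/n]*n)
import Data.Nat.Divisibility as ℕ∣
open import Data.Nat.Properties
  using (+-comm; +-assoc; +-identityʳ; +-suc; +-cancelˡ-≡; +-mono-≤; +-monoʳ-≤; *-comm; *-distribˡ-+;
         *-cancelˡ-≡; *-cancelˡ-<; *-monoʳ-≤; ≤-refl; ≤-reflexive; ≤-trans; ≤-antisym; ≰⇒>; 1+n≰n;
         m≤m+n; m≤n+m; module ≤-Reasoning)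
import Data.Nat.Tactic.RingSolver as ℕ-Solver
open import Data.Product using (∃-syntax; _×_; _,_; proj₁; proj₂)
open import Data.Sum using (_⊎_; inj₁; inj₂; [_,_]′)
open import Data.Vec using ([]; _∷_; here; there; _++_; tabulate; insertAt)
open import Data.Vec.Properties
  using (lookup∘tabulate; []=⇒lookup; lookup⇒[]=; lookup-++ˡ; lookup-++ʳ; zipWith-++; insertAt-punchIn)
open import Function using (_∘_; id)
open import Induction.WellFounded using (Acc; acc)
open import Level using (0ℓ)
open import Relation.Binary.PropositionalEquality
  using (_≡_; _≢_; refl; sym; trans; cong; cong₂; subst; subst₂; ≢-sym; module ≡-Reasoning)
open import Relation.Nullary using (¬_; Dec; yes; no; does; contradiction; ¬?; _×-dec_; _⊎-dec_)
open import Relation.Nullary.Decidable using (from-no)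
open import Relation.Unary using (Pred; Decidable) renaming (_∪_ to _⋓_; _⊆_ to _⋐_)

-- Why a K₄ appears: if the interior S between u and v is connected and no vertex separates the
-- neighbours of u from those of v, Menger's theorem gives two adjacent connected halves of S, each
-- touching both u and v. Together with u alone, and with v joined to everything outside S, they are
-- four branch sets. This needs a link between u and v outside S, so the existence of such a link is
-- carried through the recursion; for an admissible pair, the ear supplies it. Where 1 mod 3 comes
-- from: three internally disjoint u-v paths have pairwise length sums 2 mod 3, so each length is 1
-- mod 3. A mere series composition has no third path, so a chain records its number k of joints
-- until a parallel path or an edge forces 3 to divide k. Why the bounds are tripled: the rounded
-- bounds m and m + 1 are too coarse to be added along a chain. Counting 3 for a chosen interior
-- vertex and 1 for a chosen terminal, or for an unchosen one dominated from inside, gives one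
-- linear inequality that does add up. Rounding is applied only where the terminals must not be
-- charged again.

-- Congruence to 2 modulo 3, with an integer quotient so that congruences can be subtracted.
Two : ℕ → Set
Two a = ∃[ q ] (pos a ≡ pos 2 ℤ.+ pos 3 ℤ.* q)

Two-2 : Two 2
Two-2 = pos 0 , refl

residue-2 : ∀ a → ¬ (a % 3 ≡ 0 ⊎ a % 3 ≡ 1) → Two a
residue-2 a ¬01 = pos (a / 3) , (begin
  pos a                              ≡⟨ cong pos (m≡m%n+[m/n]*n a 3) ⟩
  pos (a % 3 + a / 3 * 3)            ≡⟨ cong (λ r → pos (r + a / 3 * 3)) (is-2 (a % 3) (m%n<n a 3) ¬01) ⟩
  pos 2 ℤ.+ pos (a / 3 * 3)          ≡⟨ cong (λ b → pos (2 + b)) (*-comm (a / 3) 3) ⟩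
  pos 2 ℤ.+ pos (3 * (a / 3))        ≡⟨ cong (λ b → pos 2 ℤ.+ b) (ℤ.pos-* 3 (a / 3)) ⟩
  pos 2 ℤ.+ pos 3 ℤ.* pos (a / 3)    ∎)
  where
  open ≡-Reasoning
  is-2 : ∀ r → suc r ≤ 3 → ¬ (r ≡ 0 ⊎ r ≡ 1) → r ≡ 2
  is-2 0 _ ¬p = contradiction (inj₁ refl) ¬p
  is-2 1 _ ¬p = contradiction (inj₂ refl) ¬p
  is-2 2 _ _  = refl
  is-2 (suc (suc (suc _))) (s≤s (s≤s (s≤s ()))) _

-- Because 2 + 2 - 2 = 2. The equation argument is always a ring identity between lengths, left to
-- the solver.
combine : ∀ a b c {d} → (pos a ℤ.+ pos b) ℤ.- pos c ≡ pos d → Two a → Two b → Two c → Two d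
combine a b c eq (p , a≡) (q , b≡) (r , c≡) = (p ℤ.+ q) ℤ.- r , trans (sym eq)
  (trans (cong₂ ℤ._-_ (cong₂ ℤ._+_ a≡ b≡) c≡) (identity p q r))
  where
  identity : ∀ p q r → ((pos 2 ℤ.+ pos 3 ℤ.* p) ℤ.+ (pos 2 ℤ.+ pos 3 ℤ.* q)) ℤ.- (pos 2 ℤ.+ pos 3 ℤ.* r)
                       ≡ pos 2 ℤ.+ pos 3 ℤ.* ((p ℤ.+ q) ℤ.- r)
  identity = ℤ-Solver.solve-∀

Two-+ : ∀ a {b} → Two (a + b) → ∀ {c} → Two (c + b) → ∀ {d} → Two (a + d) → Two (c + d)
Two-+ a {b} ab {c} cb {d} ad = combine (c + b) (a + d) (a + b) (identity (pos a) (pos b) (pos c) (pos d)) cb ad ab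
  where
  identity : ∀ a b c d → ((c ℤ.+ b) ℤ.+ (a ℤ.+ d)) ℤ.- (a ℤ.+ b) ≡ c ℤ.+ d
  identity = ℤ-Solver.solve-∀

-- The four triangles of K₄ cover every edge twice, and so do its three quadrilaterals.
no-K₄-weights : ∀ {a b c d e f} →
  Two (a + b + c) → Two (a + d + e) → Two (b + d + f) → Two (c + e + f) →
  Two (a + c + f + d) → Two (a + b + f + e) → Two (b + c + e + d) → ⊥
no-K₄-weights {a} {b} {c} {d} {e} {f} (t₁ , p₁) (t₂ , p₂) (t₃ , p₃) (t₄ , p₄) (q₁ , r₁) (q₂ , r₂) (q₃ , r₃) =
  from-no (3 ℕ∣.∣? 2) (ℤ∣.∣⇒∣ᵤ (ℤ∣.divides k eq))
  where
  open ≡-Reasoning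
  k = (q₁ ℤ.+ q₂ ℤ.+ q₃) ℤ.- (t₁ ℤ.+ t₂ ℤ.+ t₃ ℤ.+ t₄)
  cover : ∀ a b c d e f →
    ((a ℤ.+ b ℤ.+ c) ℤ.+ (a ℤ.+ d ℤ.+ e) ℤ.+ (b ℤ.+ d ℤ.+ f) ℤ.+ (c ℤ.+ e ℤ.+ f)) ≡
    ((a ℤ.+ c ℤ.+ f ℤ.+ d) ℤ.+ (a ℤ.+ b ℤ.+ f ℤ.+ e) ℤ.+ (b ℤ.+ c ℤ.+ e ℤ.+ d))
  cover = ℤ-Solver.solve-∀
  tri quad : ℤ
  tri = (pos 2 ℤ.+ pos 3 ℤ.* t₁) ℤ.+ (pos 2 ℤ.+ pos 3 ℤ.* t₂) ℤ.+ (pos 2 ℤ.+ pos 3 ℤ.* t₃) ℤ.+ (pos 2 ℤ.+ pos 3 ℤ.* t₄)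
  quad = (pos 2 ℤ.+ pos 3 ℤ.* q₁) ℤ.+ (pos 2 ℤ.+ pos 3 ℤ.* q₂) ℤ.+ (pos 2 ℤ.+ pos 3 ℤ.* q₃)
  tri≡quad : tri ≡ quad
  tri≡quad = trans (sym (cong₂ ℤ._+_ (cong₂ ℤ._+_ (cong₂ ℤ._+_ p₁ p₂) p₃) p₄))
    (trans (cover (pos a) (pos b) (pos c) (pos d) (pos e) (pos f)) (cong₂ ℤ._+_ (cong₂ ℤ._+_ r₁ r₂) r₃))
  -- Four residues 2 against three residues 2 leave 8 - 6 = 2; all other terms are multiples of 3.
  split : ∀ t₁ t₂ t₃ t₄ q₁ q₂ q₃ → pos 2 ≡
    (((pos 2 ℤ.+ pos 3 ℤ.* t₁) ℤ.+ (pos 2 ℤ.+ pos 3 ℤ.* t₂) ℤ.+ (pos 2 ℤ.+ pos 3 ℤ.* t₃) ℤ.+ (pos 2 ℤ.+ pos 3 ℤ.* t₄))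
     ℤ.- ((pos 2 ℤ.+ pos 3 ℤ.* q₁) ℤ.+ (pos 2 ℤ.+ pos 3 ℤ.* q₂) ℤ.+ (pos 2 ℤ.+ pos 3 ℤ.* q₃)))
    ℤ.+ ((q₁ ℤ.+ q₂ ℤ.+ q₃) ℤ.- (t₁ ℤ.+ t₂ ℤ.+ t₃ ℤ.+ t₄)) ℤ.* pos 3
  split = ℤ-Solver.solve-∀
  cancel : ∀ x y → (x ℤ.- x) ℤ.+ y ≡ y
  cancel = ℤ-Solver.solve-∀
  eq : pos 2 ≡ k ℤ.* pos 3
  eq = begin
    pos 2                              ≡⟨ split t₁ t₂ t₃ t₄ q₁ q₂ q₃ ⟩
    (tri ℤ.- quad) ℤ.+ k ℤ.* pos 3     ≡⟨ cong (λ z → (z ℤ.- quad) ℤ.+ k ℤ.* pos 3) tri≡quad ⟩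
    (quad ℤ.- quad) ℤ.+ k ℤ.* pos 3    ≡⟨ cancel quad (k ℤ.* pos 3) ⟩
    k ℤ.* pos 3                        ∎

-- Walks, simple paths and cycles inside a vertex set.

module Paths {n : ℕ} (G : SimpleGraph n) where

  infix 4 _~_
  _~_ : Fin n → Fin n → Set
  _~_ = Adj G

  ~-sym : ∀ {u v} → u ~ v → v ~ u
  ~-sym {u} {v} = subst T (adj-sym G u v)

  ~-irrefl : ∀ {u v} → u ~ v → u ≢ v
  ~-irrefl {u} u~u refl = subst T (adj-irrefl G u) u~u

  infixl 6 _∖_
  _∖_ : Pred (Fin n) 0ℓ → Fin n → Pred (Fin n) 0ℓ
  (W ∖ x) w = W w × w ≢ x

  data Walk (W : Pred (Fin n) 0ℓ) : Fin n → Fin n → Set where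
    stop : ∀ {x} → W x → Walk W x x
    go   : ∀ {x y z} → W x → x ~ y → Walk W y z → Walk W x z

  -- A simple path: each vertex is removed from W once it has been left.
  data Path (W : Pred (Fin n) 0ℓ) : Fin n → Fin n → ℕ → Set where
    stop : ∀ {x} → W x → Path W x x 0
    go   : ∀ {x y z ℓ} → W x → x ~ y → Path (W ∖ x) y z ℓ → Path W x z (suc ℓ)

  private variable
    W W₁ W₂ : Pred (Fin n) 0ℓ
    u v w x y z : Fin n
    i j ℓ : ℕ

  walk-source : Walk W x y → W x
  walk-source (stop x∈) = x∈
  walk-source (go x∈ _ _) = x∈

  walk-target : Walk W x y → W y
  walk-target (stop x∈) = x∈
  walk-target (go _ _ p) = walk-target p

  walk-mono : W₁ ⋐ W₂ → Walk W₁ x y → Walk W₂ x y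
  walk-mono f (stop x∈) = stop (f x∈)
  walk-mono f (go x∈ e p) = go (f x∈) e (walk-mono f p)

  infixr 5 _++ʷ_
  _++ʷ_ : Walk W x y → Walk W y z → Walk W x z
  stop _ ++ʷ q = q
  go x∈ e p ++ʷ q = go x∈ e (p ++ʷ q)

  walk-reverse : Walk W x y → Walk W y x
  walk-reverse (stop x∈) = stop x∈
  walk-reverse (go x∈ e p) = walk-reverse p ++ʷ go (walk-source p) (~-sym e) (stop x∈)

  path-mono : W₁ ⋐ W₂ → Path W₁ x y ℓ → Path W₂ x y ℓ
  path-mono f (stop x∈) = stop (f x∈)
  path-mono f (go x∈ e p) = go (f x∈) e (path-mono (λ (w∈ , w≢) → f w∈ , w≢) p)

  path-source : Path W x y ℓ → W x
  path-source (stop x∈) = x∈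
  path-source (go x∈ _ _) = x∈

  path-target : Path W x y ℓ → W y
  path-target (stop x∈) = x∈
  path-target (go _ _ p) = proj₁ (path-target p)

  path-concat : Path W₁ x y i → Path W₂ y z j → (∀ {w} → W₁ w → W₂ w → w ≡ y) →
                Path (W₁ ⋓ W₂) x z (i + j)
  path-concat (stop _) q _ = path-mono inj₂ q
  path-concat {W₁ = W₁} {x = x} {W₂ = W₂} (go x∈ e p) q meet =
    go (inj₁ x∈) e (path-mono avoid (path-concat p q (λ (w∈ , _) → meet w∈)))
    where
    avoid : ((W₁ ∖ x) ⋓ W₂) ⋐ ((W₁ ⋓ W₂) ∖ x)
    avoid (inj₁ (w∈ , w≢)) = inj₁ w∈ , w≢
    avoid (inj₂ w∈) = inj₂ w∈ , λ { refl → proj₂ (path-target p) (sym (meet x∈ w∈)) }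

  path-join : Path W₁ x y i → y ~ u → Path W₂ u z j → (∀ {w} → W₁ w → W₂ w → ⊥) →
              Path (W₁ ⋓ W₂) x z (i + suc j)
  path-join {W₁ = W₁} {y = y} {W₂ = W₂} p e q disjoint =
    path-mono shrink (path-concat p (go (inj₁ refl) e (path-mono grow q)) meet)
    where
    grow : W₂ ⋐ (((_≡ y) ⋓ W₂) ∖ y)
    grow w∈ = inj₂ w∈ , λ { refl → disjoint (path-target p) w∈ }
    meet : ∀ {w} → W₁ w → ((_≡ y) ⋓ W₂) w → w ≡ y
    meet _ (inj₁ w≡) = w≡
    meet w∈₁ (inj₂ w∈₂) = ⊥-elim (disjoint w∈₁ w∈₂)
    shrink : (W₁ ⋓ ((_≡ y) ⋓ W₂)) ⋐ (W₁ ⋓ W₂)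
    shrink (inj₁ w∈) = inj₁ w∈
    shrink (inj₂ (inj₁ refl)) = inj₁ (path-target p)
    shrink (inj₂ (inj₂ w∈)) = inj₂ w∈

  path-reverse : Path W x y ℓ → Path W y x ℓ
  path-reverse (stop x∈) = stop x∈
  path-reverse {W = W} {x = x} {y = y} (go {ℓ = ℓ} x∈ e p) =
    subst (Path W y x) (+-comm ℓ 1)
      (path-mono (λ { (inj₁ (w∈ , _)) → w∈ ; (inj₂ refl) → x∈ })
        (path-join (path-reverse p) (~-sym e) (stop {W = _≡ x} refl) (λ { (_ , w≢) refl → w≢ refl })))

  -- Loop erasure for `walk⇒path`: if the path comes back to x, its tail from x replaces the whole
  -- detour.
  avoid-or-restart : ∀ x → Path W y z ℓ → Path (W ∖ x) y z ℓ ⊎ ∃[ i ] Path W x z i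
  avoid-or-restart {y = y} x p with x ≟ y
  avoid-or-restart x p | yes refl = inj₂ (_ , p)
  avoid-or-restart x (stop y∈) | no x≢y = inj₁ (stop (y∈ , ≢-sym x≢y))
  avoid-or-restart x (go y∈ e p) | no x≢y with avoid-or-restart x p
  ... | inj₁ p′ = inj₁ (go (y∈ , ≢-sym x≢y) e (path-mono (λ ((w∈ , a) , b) → (w∈ , b) , a) p′))
  ... | inj₂ (i , p′) = inj₂ (i , path-mono proj₁ p′)

  walk⇒path : Walk W x y → ∃[ ℓ ] Path W x y ℓ
  walk⇒path (stop x∈) = 0 , stop x∈
  walk⇒path {x = x} (go x∈ e p) with walk⇒path p
  ... | ℓ , q with avoid-or-restart x q
  ... | inj₁ q′ = suc ℓ , go x∈ e q′
  ... | inj₂ q′ = q′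

  private
    vertex : Path W x y ℓ → Fin (suc ℓ) → Fin n
    vertex {x = x} _ zero = x
    vertex (go _ _ p) (suc i) = vertex p i

    vertex-in : (p : Path W x y ℓ) → ∀ i → W (vertex p i)
    vertex-in p zero = path-source p
    vertex-in (go _ _ p) (suc i) = proj₁ (vertex-in p i)

    vertex-injective : (p : Path W x y ℓ) → ∀ {i j} → vertex p i ≡ vertex p j → i ≡ j
    vertex-injective p {zero} {zero} _ = refl
    vertex-injective (go _ _ p) {zero} {suc j} eq = contradiction (sym eq) (proj₂ (vertex-in p j))
    vertex-injective (go _ _ p) {suc i} {zero} eq = contradiction eq (proj₂ (vertex-in p i))
    vertex-injective (go _ _ p) {suc i} {suc j} eq = cong suc (vertex-injective p eq)

    vertex-step : (p : Path W x y ℓ) → ∀ i → vertex p (inject₁ i) ~ vertex p (suc i)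
    vertex-step (go _ e (stop _)) zero = e
    vertex-step (go _ e (go _ _ _)) zero = e
    vertex-step (go _ _ p) (suc i) = vertex-step p i

    vertex-last : (p : Path W x y ℓ) → vertex p (fromℕ ℓ) ≡ y
    vertex-last (stop _) = refl
    vertex-last (go _ _ p) = vertex-last p

  close-path : Path W x y ℓ → 2 ≤ ℓ → y ~ x → Cycle G (suc ℓ)
  close-path {x = x} {ℓ = ℓ} p 2≤ℓ e = record
    { k = ℓ ; len≡ = refl ; long = s≤s 2≤ℓ ; verts = vertex p
    ; inj = vertex-injective p ; steps = vertex-step p
    ; close = subst (_~ x) (sym (vertex-last p)) e }

  _HitBy_ : Fin n → Path W x y ℓ → Set
  w HitBy (stop {x} _) = w ≡ x
  w HitBy (go {x} _ _ p) = w ≡ x ⊎ w HitBy p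

  hitBy? : ∀ w (p : Path W x y ℓ) → Dec (w HitBy p)
  hitBy? w (stop {x} _) = w ≟ x
  hitBy? w (go {x} _ _ p) = w ≟ x ⊎-dec hitBy? w p

  hit⇒in : (p : Path W x y ℓ) → (_HitBy p) ⋐ W
  hit⇒in (stop x∈) refl = x∈
  hit⇒in (go x∈ _ p) (inj₁ refl) = x∈
  hit⇒in (go x∈ _ p) (inj₂ hit) = proj₁ (hit⇒in p hit)

  target-hit : (p : Path W x y ℓ) → y HitBy p
  target-hit (stop _) = refl
  target-hit (go _ _ p) = inj₂ (target-hit p)

  private
    prepend : (x∈ : W x) (e : x ~ y) (p : Path (W ∖ x) y z ℓ) →
              Path (_HitBy p) y w i → Path (_HitBy (go x∈ e p)) x w (suc i)
    prepend _ e p q = go (inj₁ refl) e (path-mono (λ hit → inj₂ hit , proj₂ (hit⇒in p hit)) q)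

  self-path : (p : Path W x y ℓ) → Path (_HitBy p) x y ℓ
  self-path (stop _) = stop refl
  self-path (go x∈ e p) = prepend x∈ e p (self-path p)

  path-split : (p : Path W x y ℓ) → w HitBy p →
               ∃[ i ] ∃[ j ] (i + j ≡ ℓ × Path (_HitBy p) x w i × Path (_HitBy p) w y j)
  path-split (stop x∈) refl = 0 , 0 , refl , stop refl , stop refl
  path-split p@(go _ _ _) (inj₁ refl) = 0 , _ , refl , stop (inj₁ refl) , self-path p
  path-split (go x∈ e p) (inj₂ hit) with path-split p hit
  ... | i , j , eq , q , r = suc i , j , cong suc eq , prepend x∈ e p q , path-mono inj₂ r

  -- The walk is followed only until it first hits p, which happens at y at the latest. The part
  -- before d therefore avoids p.
  approach : (p : Path W x y ℓ) → Walk W z y →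
             ∃[ c ] (c HitBy p × (z ≡ c ⊎ ∃[ d ] (d ~ c × Walk (λ w → W w × ¬ (w HitBy p)) z d)))
  approach {z = z} p q with hitBy? z p
  approach {z = z} p q | yes hit = z , hit , inj₁ refl
  approach p (stop _) | no miss = contradiction (target-hit p) miss
  approach p (go z∈ e q) | no miss with approach p q
  ... | c , hit , inj₁ refl = c , hit , inj₂ (_ , e , stop (z∈ , miss))
  ... | c , hit , inj₂ (d , d~c , r) = c , hit , inj₂ (d , d~c , go (z∈ , miss) e r)

  Connected-in : Pred (Fin n) 0ℓ → Set
  Connected-in W = ∀ {x y} → W x → W y → Walk W x y

  -- `lx`, `ly`, `lz` are the lengths of three legs from a common centre. The centre itself is not
  -- kept: a cycle through a branch set only enters and leaves by two of the three contact points.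
  -- Legs may have length 0.
  record Tripod (W : Pred (Fin n) 0ℓ) (x y z : Fin n) : Set where
    field
      lx ly lz : ℕ
      xy : Path W x y (lx + ly)
      xz : Path W x z (lx + lz)
      yz : Path W y z (ly + lz)

  tripod : Connected-in W → W x → W y → W z → Tripod W x y z
  tripod {W = W} {x = x} {y = y} connected x∈ y∈ z∈ with walk⇒path (connected x∈ y∈)
  ... | ℓ , p with approach p (connected z∈ y∈)
  ... | c , hit , leg with path-split p hit
  tripod {W = W} {y = y} connected x∈ y∈ z∈ | ℓ , p | c , hit , inj₁ refl | i , j , refl , q , r = record
    { lx = i ; ly = j ; lz = 0 ; xy = p
    ; xz = subst (Path W _ c) (sym (+-identityʳ i)) (path-mono (hit⇒in p) q)
    ; yz = subst (Path W y c) (sym (+-identityʳ j)) (path-mono (hit⇒in p) (path-reverse r)) }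
  tripod connected x∈ y∈ z∈ | ℓ , p | c , hit , inj₂ (d , d~c , leg) | i , j , refl , q , r
    with walk⇒path (walk-reverse leg)
  ... | k , leg′ = record
    { lx = i ; ly = j ; lz = suc k ; xy = p
    ; xz = path-mono back (path-join q (~-sym d~c) leg′ (λ hit (_ , miss) → miss hit))
    ; yz = path-mono back (path-join (path-reverse r) (~-sym d~c) leg′ (λ hit (_ , miss) → miss hit)) }
    where
    back : ((_HitBy p) ⋓ (λ w → _ × ¬ (w HitBy p))) ⋐ _
    back (inj₁ hit) = hit⇒in p hit
    back (inj₂ (w∈ , _)) = w∈

  -- Cycle lengths and the exclusion of K₄ minors.

  Touching : (W₁ W₂ : Pred (Fin n) 0ℓ) → Set
  Touching W₁ W₂ = ∃[ x ] ∃[ y ] (W₁ x × W₂ y × x ~ y)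

  Disjoint : (W₁ W₂ : Pred (Fin n) 0ℓ) → Set
  Disjoint W₁ W₂ = ∀ {w} → W₁ w → W₂ w → ⊥

  record K₄-Minor : Set₁ where
    field
      B₀ B₁ B₂ B₃ : Pred (Fin n) 0ℓ
      conn₀ : Connected-in B₀
      conn₁ : Connected-in B₁
      conn₂ : Connected-in B₂
      conn₃ : Connected-in B₃
      disj₀₁ : Disjoint B₀ B₁
      disj₀₂ : Disjoint B₀ B₂
      disj₀₃ : Disjoint B₀ B₃
      disj₁₂ : Disjoint B₁ B₂
      disj₁₃ : Disjoint B₁ B₃
      disj₂₃ : Disjoint B₂ B₃
      edge₀₁ : Touching B₀ B₁
      edge₀₂ : Touching B₀ B₂
      edge₀₃ : Touching B₀ B₃
      edge₁₂ : Touching B₁ B₂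
      edge₁₃ : Touching B₁ B₃
      edge₂₃ : Touching B₂ B₃

  module Ternary (ternary : Ternary01 G) where

    cycle-length : Cycle G ℓ → Two ℓ
    cycle-length {ℓ} c = residue-2 ℓ (ternary ℓ c)

    -- The two paths close up to a cycle unless both are the edge uv. In that degenerate case the
    -- sum is 2, which happens to have the right residue, so later arguments need not distinguish
    -- it.
    two-paths : u ≢ v → Path W₁ u v i → Path W₂ v u j →
                (∀ {w} → W₁ w → W₂ w → w ≡ u ⊎ w ≡ v) → Two (i + j)
    two-paths u≢v (stop _) _ _ = contradiction refl u≢v
    two-paths u≢v (go _ _ _) (stop _) _ = contradiction refl u≢v
    two-paths u≢v (go _ _ (stop _)) (go _ _ (stop _)) _ = Two-2
    two-paths {u = u} {v = v} {W₁ = W₁} {W₂ = W₂} u≢v (go {ℓ = i} _ e p) q@(go {ℓ = j} _ _ _) meet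
      with 2 ≤? i + suc j
    ... | yes 2≤ = cycle-length (close-path (path-concat p q meet′) 2≤ e)
      where
      meet′ : ∀ {w} → (W₁ ∖ u) w → W₂ w → w ≡ v
      meet′ (w∈₁ , w≢u) w∈₂ = [ (λ w≡u → contradiction w≡u w≢u) , id ]′ (meet w∈₁ w∈₂)
    ... | no ¬2≤ = subst Two (cong suc (≤-antisym 1≤ (s≤s⁻¹ (≰⇒> ¬2≤)))) Two-2
      where
      1≤ : 1 ≤ i + suc j
      1≤ = ≤-trans (s≤s z≤n) (m≤n+m (suc j) i)

    private
      cycle₃ : ∀ {a a′ b b′ c c′ k} →
        Disjoint W₁ W₂ → Disjoint W₁ W → Disjoint W₂ W →
        Path W₁ a a′ i → a′ ~ b → Path W₂ b b′ j → b′ ~ c → Path W c c′ k → c′ ~ a →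
        Two (suc (i + suc j + suc k))
      cycle₃ {i = i} {j = j} {k = k} d₁₂ d₁ d₂ p e q f r g = cycle-length (close-path
        (path-join (path-join p e q d₁₂) f r [ d₁ , d₂ ]′) 2≤ g)
        where
        2≤ : 2 ≤ i + suc j + suc k
        2≤ = +-mono-≤ {1} {i + suc j} (≤-trans (s≤s z≤n) (m≤n+m (suc j) i)) (s≤s z≤n)

      cycle₄ : ∀ {W₃ W₄ : Pred (Fin n) 0ℓ} {a a′ b b′ c c′ d d′ k l} →
        Disjoint W₁ W₂ → Disjoint W₁ W₃ → Disjoint W₁ W₄ →
        Disjoint W₂ W₃ → Disjoint W₂ W₄ → Disjoint W₃ W₄ →
        Path W₁ a a′ i → a′ ~ b → Path W₂ b b′ j → b′ ~ c → Path W₃ c c′ k → c′ ~ d →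
        Path W₄ d d′ l → d′ ~ a → Two (suc (i + suc j + suc k + suc l))
      cycle₄ d₁₂ d₁₃ d₁₄ d₂₃ d₂₄ d₃₄ p e q f r g s h =
        cycle₃ [ d₁₃ , d₂₃ ]′ [ d₁₄ , d₂₄ ]′ d₃₄ (path-join p e q d₁₂) f r g s h

    -- A tripod in each branch set yields a subdivided K₄. The weight of an edge of K₄ is the
    -- contact edge plus one leg at either end; every triangle and quadrilateral of K₄ then lifts to
    -- a cycle whose length is the sum of its weights.
    no-K₄-minor : ¬ K₄-Minor
    no-K₄-minor K = no-K₄-weights {e₀₁} {e₀₂} {e₁₂} {e₀₃} {e₁₃} {e₂₃}
      (subst Two (triangle (lx T₀) (ly T₀) (lx T₁) (ly T₁) (lx T₂) (ly T₂))
        (cycle₃ disj₀₁ disj₀₂ disj₁₂ (path-reverse (xy T₀)) x₀₁ (xy T₁) x₁₂ (path-reverse (xy T₂)) (~-sym x₀₂)))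
      (subst Two (triangle (lx T₀) (lz T₀) (lx T₁) (lz T₁) (lx T₃) (ly T₃))
        (cycle₃ disj₀₁ disj₀₃ disj₁₃ (path-reverse (xz T₀)) x₀₁ (xz T₁) x₁₃ (path-reverse (xy T₃)) (~-sym x₀₃)))
      (subst Two (triangle (ly T₀) (lz T₀) (lx T₂) (lz T₂) (lx T₃) (lz T₃))
        (cycle₃ disj₀₂ disj₀₃ disj₂₃ (path-reverse (yz T₀)) x₀₂ (xz T₂) x₂₃ (path-reverse (xz T₃)) (~-sym x₀₃)))
      (subst Two (triangle (ly T₁) (lz T₁) (ly T₂) (lz T₂) (ly T₃) (lz T₃))
        (cycle₃ disj₁₂ disj₁₃ disj₂₃ (path-reverse (yz T₁)) x₁₂ (yz T₂) x₂₃ (path-reverse (yz T₃)) (~-sym x₁₃)))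
      (subst Two (quad (lx T₀) (lz T₀) (lx T₁) (ly T₁) (ly T₂) (lz T₂) (lx T₃) (lz T₃))
        (cycle₄ disj₀₁ disj₀₂ disj₀₃ disj₁₂ disj₁₃ disj₂₃
          (path-reverse (xz T₀)) x₀₁ (xy T₁) x₁₂ (yz T₂) x₂₃ (path-reverse (xz T₃)) (~-sym x₀₃)))
      (subst Two (quad′ (lx T₀) (ly T₀) (lx T₁) (lz T₁) (ly T₃) (lz T₃) (lx T₂) (lz T₂))
        (cycle₄ disj₀₁ disj₀₃ disj₀₂ disj₁₃ disj₁₂ (λ a b → disj₂₃ b a)
          (path-reverse (xy T₀)) x₀₁ (xz T₁) x₁₃ (yz T₃) (~-sym x₂₃) (path-reverse (xz T₂)) (~-sym x₀₂)))
      (subst Two (quad″ (ly T₀) (lz T₀) (lx T₂) (ly T₂) (ly T₁) (lz T₁) (lx T₃) (ly T₃))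
        (cycle₄ disj₀₂ disj₀₁ disj₀₃ (λ a b → disj₁₂ b a) disj₂₃ disj₁₃
          (path-reverse (yz T₀)) x₀₂ (xy T₂) (~-sym x₁₂) (yz T₁) x₁₃ (path-reverse (xy T₃)) (~-sym x₀₃)))
      where
      open K₄-Minor K
      open Tripod
      src : Touching W₁ W₂ → Fin n
      src = proj₁
      tgt : Touching W₁ W₂ → Fin n
      tgt t = proj₁ (proj₂ t)
      src∈ : (t : Touching W₁ W₂) → W₁ (src t)
      src∈ (_ , _ , s , _) = s
      tgt∈ : (t : Touching W₁ W₂) → W₂ (tgt t)
      tgt∈ (_ , _ , _ , t , _) = t
      link : (t : Touching W₁ W₂) → src t ~ tgt t
      link (_ , _ , _ , _ , e) = e
      x₀₁ = link edge₀₁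
      x₀₂ = link edge₀₂
      x₀₃ = link edge₀₃
      x₁₂ = link edge₁₂
      x₁₃ = link edge₁₃
      x₂₃ = link edge₂₃
      T₀ = tripod conn₀ (src∈ edge₀₁) (src∈ edge₀₂) (src∈ edge₀₃)
      T₁ = tripod conn₁ (tgt∈ edge₀₁) (src∈ edge₁₂) (src∈ edge₁₃)
      T₂ = tripod conn₂ (tgt∈ edge₀₂) (tgt∈ edge₁₂) (src∈ edge₂₃)
      T₃ = tripod conn₃ (tgt∈ edge₀₃) (tgt∈ edge₁₃) (tgt∈ edge₂₃)
      e₀₁ = suc (lx T₀ + lx T₁)
      e₀₂ = suc (ly T₀ + lx T₂)
      e₀₃ = suc (lz T₀ + lx T₃)
      e₁₂ = suc (ly T₁ + ly T₂)
      e₁₃ = suc (lz T₁ + ly T₃)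
      e₂₃ = suc (lz T₂ + lz T₃)
      triangle : ∀ a b c d e f →
        suc (a + b + suc (c + d) + suc (e + f)) ≡ suc (a + c) + suc (b + e) + suc (d + f)
      triangle = ℕ-Solver.solve-∀
      quad : ∀ a b c d e f g h →
        suc (a + b + suc (c + d) + suc (e + f) + suc (g + h)) ≡
        suc (a + c) + suc (d + e) + suc (f + h) + suc (b + g)
      quad = ℕ-Solver.solve-∀
      quad′ : ∀ a b c d e f g h →
        suc (a + b + suc (c + d) + suc (e + f) + suc (g + h)) ≡
        suc (a + c) + suc (b + g) + suc (h + f) + suc (d + e)
      quad′ = ℕ-Solver.solve-∀
      quad″ : ∀ a b c d e f g h →
        suc (a + b + suc (c + d) + suc (e + f) + suc (g + h)) ≡
        suc (a + c) + suc (e + d) + suc (f + h) + suc (b + g)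
      quad″ = ℕ-Solver.solve-∀

-- Closures, components and Menger's theorem.

module Comprehension {n : ℕ} {P : Pred (Fin n) 0ℓ} (P? : Decidable P) where

  comprehension : Subset n
  comprehension = tabulate (does ∘ P?)

  ∈-comprehension⁺ : ∀ {x} → P x → x ∈ comprehension
  ∈-comprehension⁺ {x} px = lookup⇒[]= x comprehension (trans (lookup∘tabulate (does ∘ P?) x) (is-true (P? x)))
    where
    is-true : (d : Dec (P x)) → does d ≡ true
    is-true (yes _) = refl
    is-true (no ¬px) = contradiction px ¬px

  ∈-comprehension⁻ : ∀ {x} → x ∈ comprehension → P x
  ∈-comprehension⁻ {x} x∈ = extract (P? x) (trans (sym (lookup∘tabulate (does ∘ P?) x)) ([]=⇒lookup x∈))
    where
    extract : (d : Dec (P x)) → does d ≡ true → P x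
    extract (yes px) _ = px
    extract (no _) ()

open Comprehension

module Connectivity {n : ℕ} (G : SimpleGraph n) where
  open Paths G public

  Connected-set : Subset n → Set
  Connected-set S = Connected-in (_∈ S)

  Closed-in : Subset n → Subset n → Set
  Closed-in T D = ∀ {d w} → d ∈ D → w ∈ T → d ~ w → w ∈ D

  walk-stays : ∀ {T D x y} → Closed-in T D → x ∈ D → Walk (_∈ T) x y → Walk (_∈ D) x y
  walk-stays closed x∈ (stop _) = stop x∈
  walk-stays closed x∈ (go _ e p) = go x∈ e (walk-stays closed (closed x∈ (walk-source p) e) p)

  record Closure (T seed : Subset n) : Set where
    field
      hull : Subset n
      hull⊆ : hull ⊆ T
      seed⊆ : seed ⊆ hull
      closed : Closed-in T hull
      rooted : ∀ {d} → d ∈ hull → ∃[ r ] (r ∈ seed × Walk (_∈ hull) r d)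

  closure : ∀ T seed → seed ⊆ T → Closure T seed
  closure T seed seed⊆T = grow seed (⊃-wellFounded seed) seed⊆T id (λ d∈ → _ , d∈ , stop d∈)
    where
    grow : ∀ D → Acc _⊃_ D → D ⊆ T → seed ⊆ D →
           (∀ {d} → d ∈ D → ∃[ r ] (r ∈ seed × Walk (_∈ D) r d)) → Closure T seed
    grow D (acc rec) D⊆ seed⊆ rooted
      with any? (λ d → any? (λ w → d ∈? D ×-dec (w ∈? T ×-dec (¬? (w ∈? D) ×-dec T? (adj G d w)))))
    ... | no maximal = record
      { hull = D ; hull⊆ = D⊆ ; seed⊆ = seed⊆ ; rooted = rooted ; closed = closed }
      where
      closed : Closed-in T D
      closed {d} {w} d∈ w∈ e with w ∈? D
      ... | yes w∈D = w∈D
      ... | no w∉D = contradiction (d , w , d∈ , w∈ , w∉D , e) maximal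
    ... | yes (d , w , d∈ , w∈ , w∉ , e) =
      grow (D ∪ ⁅ w ⁆) (rec (p⊆p∪q _ , w , w∈D′ , w∉)) D′⊆ (p⊆p∪q _ ∘ seed⊆) rooted′
      where
      w∈D′ : w ∈ D ∪ ⁅ w ⁆
      w∈D′ = x∈p∪q⁺ (inj₂ (x∈⁅x⁆ w))
      D′⊆ : D ∪ ⁅ w ⁆ ⊆ T
      D′⊆ x∈ with x∈p∪q⁻ D ⁅ w ⁆ x∈
      ... | inj₁ x∈D = D⊆ x∈D
      ... | inj₂ x∈w = subst (_∈ T) (sym (x∈⁅y⁆⇒x≡y w x∈w)) w∈
      rooted′ : ∀ {x} → x ∈ D ∪ ⁅ w ⁆ → ∃[ r ] (r ∈ seed × Walk (_∈ D ∪ ⁅ w ⁆) r x)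
      rooted′ x∈ with x∈p∪q⁻ D ⁅ w ⁆ x∈
      ... | inj₁ x∈D = let r , r∈ , p = rooted x∈D in r , r∈ , walk-mono (p⊆p∪q _) p
      ... | inj₂ x∈w with x∈⁅y⁆⇒x≡y w x∈w
      ... | refl = let r , r∈ , p = rooted d∈ in
        r , r∈ , walk-mono (p⊆p∪q _) p ++ʷ go (p⊆p∪q _ d∈) e (stop w∈D′)

  rooted⇒connected : ∀ {W : Pred (Fin n) 0ℓ} r → (∀ {x} → W x → Walk W r x) → Connected-in W
  rooted⇒connected r walk x∈ y∈ = walk-reverse (walk x∈) ++ʷ walk y∈

  record Component (T : Subset n) (s : Fin n) : Set where
    field
      part : Subset n
      part⊆ : part ⊆ T
      member : s ∈ part
      connected : Connected-set part
      closed : Closed-in T part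

  component : ∀ T {s} → s ∈ T → Component T s
  component T {s} s∈ = record
    { part = hull ; part⊆ = hull⊆ ; member = seed⊆ (x∈⁅x⁆ s) ; closed = closed
    ; connected = rooted⇒connected s (λ x∈ → reroot (rooted x∈)) }
    where
    open Closure (closure T ⁅ s ⁆ (λ x∈ → subst (_∈ T) (sym (x∈⁅y⁆⇒x≡y s x∈)) s∈))
    reroot : ∀ {x} → ∃[ r ] (r ∈ ⁅ s ⁆ × Walk (_∈ hull) r x) → Walk (_∈ hull) s x
    reroot (r , r∈ , p) = subst (λ r → Walk _ r _) (x∈⁅y⁆⇒x≡y s r∈) p

  Meets : Subset n → Pred (Fin n) 0ℓ → Set
  Meets X A = ∃[ a ] (a ∈ X × A a)

  Separates : Subset n → Pred (Fin n) 0ℓ → Pred (Fin n) 0ℓ → Fin n → Set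
  Separates S A B x = ∀ {a b} → A a → B b → ¬ Walk ((_∈ S) ∖ x) a b

  -- Two sets covering S, rather than two paths: when S is connected they are automatically
  -- adjacent, which supplies the last edge of the K₄ minor.
  record Linkage (S : Subset n) (A B : Pred (Fin n) 0ℓ) : Set where
    field
      X Y : Subset n
      cover : ∀ {s} → s ∈ S → s ∈ X ⊎ s ∈ Y
      X⊆ : X ⊆ S
      Y⊆ : Y ⊆ S
      disjoint : Disjoint (_∈ X) (_∈ Y)
      X-connected : Connected-set X
      Y-connected : Connected-set Y
      X-A : Meets X A
      X-B : Meets X B
      Y-A : Meets Y A
      Y-B : Meets Y B

  -- Induction step for Menger's theorem: D is a component of S - a meeting A and B.  If B does not
  -- meet F = S - D, then in D the neighbours of a may take over the role of a in A.
  module Menger-step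
    {S : Subset n} {A B : Pred (Fin n) 0ℓ} (S-conn : Connected-set S) {a : Fin n} (a∈S : a ∈ S) (Aa : A a)
    {D : Subset n} (D⊆S : D ⊆ S) (a∉D : a ∉ D) (D-conn : Connected-set D)
    (D-closed : ∀ {d w} → d ∈ D → w ∈ S → w ≢ a → d ~ w → w ∈ D)
    {a′ : Fin n} (a′∈D : a′ ∈ D) (Aa′ : A a′) (D-B : Meets D B) where

    F? : Decidable (λ w → w ∈ S × w ∉ D)
    F? w = w ∈? S ×-dec ¬? (w ∈? D)
    F : Subset n
    F = comprehension F?
    F⁻ : ∀ {w} → w ∈ F → w ∈ S × w ∉ D
    F⁻ = ∈-comprehension⁻ F?
    F⁺ : ∀ {w} → w ∈ S → w ∉ D → w ∈ F
    F⁺ w∈ w∉ = ∈-comprehension⁺ F? (w∈ , w∉)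
    a∈F : a ∈ F
    a∈F = F⁺ a∈S a∉D

    leave : ∀ {d w} → d ∈ D → w ∈ S → w ∉ D → d ~ w → w ≡ a
    leave {w = w} d∈ w∈ w∉ e with w ≟ a
    ... | yes w≡a = w≡a
    ... | no w≢a = contradiction (D-closed d∈ w∈ w≢a e) w∉

    F-to-a : ∀ {f} → f ∉ D → Walk (_∈ S) f a → Walk (_∈ F) f a
    F-to-a f∉ (stop _) = stop a∈F
    F-to-a {f} f∉ (go {y = w} f∈ e p) with w ∈? D
    ... | no w∉ = go (F⁺ f∈ f∉) e (F-to-a w∉ p)
    ... | yes w∈ with leave w∈ f∈ f∉ (~-sym e)
    ... | refl = stop a∈F

    F-walk : ∀ {f} → f ∈ F → Walk (_∈ F) f a
    F-walk f∈ = let f∈S , f∉D = F⁻ f∈ in F-to-a f∉D (S-conn f∈S a∈S)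

    F-connected : Connected-set F
    F-connected = rooted⇒connected a (walk-reverse ∘ F-walk)

    A′ : Pred (Fin n) 0ℓ
    A′ = A ⋓ (a ~_)

    D-touches-a : ∀ {d} → d ∈ D → Walk (_∈ S) d a → Meets D (a ~_)
    D-touches-a d∈ (stop _) = contradiction d∈ a∉D
    D-touches-a {d} d∈ (go {y = w} _ e p) with w ∈? D
    ... | yes w∈ = D-touches-a w∈ p
    ... | no w∉ with leave d∈ (walk-source p) w∉ e
    ... | refl = d , d∈ , ~-sym e

    -- As F misses B, a walk to B ends inside D. D can be entered only from a, so the final stretch
    -- in D starts at a neighbour of a, unless the whole walk runs in D and starts in A.
    lift-separator : ¬ Meets F B → ∀ {x} → Separates D A′ B x → Separates S A B x
    lift-separator ¬F-B {x} sep Aa₁ Bb p =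
      [ sep (inj₁ Aa₁) Bb , (λ (_ , a~w , q) → sep (inj₂ a~w) Bb q) ]′ (confine p)
      where
      confine : ∀ {c} → Walk ((_∈ S) ∖ x) c _ →
                Walk ((_∈ D) ∖ x) c _ ⊎ ∃[ w ] (a ~ w × Walk ((_∈ D) ∖ x) w _)
      confine (stop {b} (b∈ , b≢)) with b ∈? D
      ... | yes b∈D = inj₁ (stop (b∈D , b≢))
      ... | no b∉D = contradiction (b , F⁺ b∈ b∉D , Bb) ¬F-B
      confine (go {x = c} (c∈ , c≢) e q) with confine q
      ... | inj₂ r = inj₂ r
      ... | inj₁ r with c ∈? D
      ... | yes c∈D = inj₁ (go (c∈D , c≢) e r)
      ... | no c∉D with leave (proj₁ (walk-source r)) c∈ c∉D (~-sym e)
      ... | refl = inj₂ (_ , e , r)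

    -- The side with a neighbour of a takes all of F, which is connected and contains a, and thereby
    -- meets A. The other side has to meet A on its own.
    absorb : ∀ {X Y} → (∀ {s} → s ∈ D → s ∈ X ⊎ s ∈ Y) → X ⊆ D → Y ⊆ D →
      Disjoint (_∈ X) (_∈ Y) → Connected-set X → Connected-set Y →
      Meets X (a ~_) → Meets X B → Meets Y A → Meets Y B → Linkage S A B
    absorb {X} {Y} cover X⊆ Y⊆ disj X-conn Y-conn (w , w∈X , a~w) (b , b∈X , Bb) Y-A Y-B = record
      { X = X ∪ F ; Y = Y ; cover = cover′ ; X⊆ = ⊆S ; Y⊆ = D⊆S ∘ Y⊆
      ; disjoint = λ x∈ y∈ → [ (λ x∈X → disj x∈X y∈) , (λ x∈F → proj₂ (F⁻ x∈F) (Y⊆ y∈)) ]′ (x∈p∪q⁻ X F x∈)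
      ; X-connected = rooted⇒connected a walk ; Y-connected = Y-conn
      ; X-A = a , x∈p∪q⁺ (inj₂ a∈F) , Aa ; X-B = b , x∈p∪q⁺ (inj₁ b∈X) , Bb
      ; Y-A = Y-A ; Y-B = Y-B }
      where
      cover′ : ∀ {s} → s ∈ S → s ∈ X ∪ F ⊎ s ∈ Y
      cover′ {s} s∈ with s ∈? D
      ... | no s∉ = inj₁ (x∈p∪q⁺ (inj₂ (F⁺ s∈ s∉)))
      ... | yes s∈D = [ inj₁ ∘ x∈p∪q⁺ ∘ inj₁ , inj₂ ]′ (cover s∈D)
      ⊆S : X ∪ F ⊆ S
      ⊆S x∈ = [ D⊆S ∘ X⊆ , proj₁ ∘ F⁻ ]′ (x∈p∪q⁻ X F x∈)
      walk : ∀ {x} → x ∈ X ∪ F → Walk (_∈ X ∪ F) a x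
      walk x∈ with x∈p∪q⁻ X F x∈
      ... | inj₁ x∈X = go (x∈p∪q⁺ (inj₂ a∈F)) a~w (walk-mono (x∈p∪q⁺ ∘ inj₁) (X-conn w∈X x∈X))
      ... | inj₂ x∈F = walk-mono (x∈p∪q⁺ ∘ inj₂) (walk-reverse (F-walk x∈F))

    extend : Linkage D A′ B → Linkage S A B
    extend L = choose X-A Y-A (cover a′∈D) (cover (proj₁ (proj₂ touch)))
      where
      open Linkage L
      touch = D-touches-a a′∈D (S-conn (D⊆S a′∈D) a∈S)
      into-X : Meets X (a ~_) → Meets Y A → Linkage S A B
      into-X X-N Y-A = absorb cover X⊆ Y⊆ disjoint X-connected Y-connected X-N X-B Y-A Y-B
      into-Y : Meets Y (a ~_) → Meets X A → Linkage S A B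
      into-Y Y-N X-A = absorb ([ inj₂ , inj₁ ]′ ∘ cover) Y⊆ X⊆ (λ y∈ x∈ → disjoint x∈ y∈)
        Y-connected X-connected Y-N Y-B X-A X-B
      -- If both sides meet A, the vertex of D next to a decides which of them takes F. If each side
      -- is only given with a neighbour of a, the one containing a′ meets A and the other takes F.
      choose : Meets X A′ → Meets Y A′ → a′ ∈ X ⊎ a′ ∈ Y → proj₁ touch ∈ X ⊎ proj₁ touch ∈ Y → Linkage S A B
      choose (x , x∈ , inj₁ Ax) (y , y∈ , inj₁ Ay) _ (inj₁ w∈) =
          into-X (_ , w∈ , proj₂ (proj₂ touch)) (y , y∈ , Ay)
      choose (x , x∈ , inj₁ Ax) (y , y∈ , inj₁ Ay) _ (inj₂ w∈) =
          into-Y (_ , w∈ , proj₂ (proj₂ touch)) (x , x∈ , Ax)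
      choose (x , x∈ , inj₁ Ax) (y , y∈ , inj₂ a~y) _ _ = into-Y (y , y∈ , a~y) (x , x∈ , Ax)
      choose (x , x∈ , inj₂ a~x) (y , y∈ , inj₁ Ay) _ _ = into-X (x , x∈ , a~x) (y , y∈ , Ay)
      choose (x , x∈ , inj₂ a~x) (y , y∈ , inj₂ a~y) (inj₁ a′∈) _ = into-Y (y , y∈ , a~y) (a′ , a′∈ , Aa′)
      choose (x , x∈ , inj₂ a~x) (y , y∈ , inj₂ a~y) (inj₂ a′∈) _ = into-X (x , x∈ , a~x) (a′ , a′∈ , Aa′)

    split : Decidable B → (∃[ x ] (x ∈ D × Separates D A′ B x)) ⊎ Linkage D A′ B →
            (∃[ x ] (x ∈ S × Separates S A B x)) ⊎ Linkage S A B
    split B? in-D with any? (λ b → b ∈? F ×-dec B? b)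
    ... | yes F-B = inj₂ (record
      { X = F ; Y = D ; cover = cover ; X⊆ = proj₁ ∘ F⁻ ; Y⊆ = D⊆S
      ; disjoint = λ x∈ → proj₂ (F⁻ x∈) ; X-connected = F-connected ; Y-connected = D-conn
      ; X-A = a , a∈F , Aa ; X-B = F-B ; Y-A = a′ , a′∈D , Aa′ ; Y-B = D-B })
      where
      cover : ∀ {s} → s ∈ S → s ∈ F ⊎ s ∈ D
      cover {s} s∈ with s ∈? D
      ... | yes s∈D = inj₂ s∈D
      ... | no s∉D = inj₁ (F⁺ s∈ s∉D)
    ... | no ¬F-B with in-D
    ... | inj₁ (x , x∈ , sep) = inj₁ (x , D⊆S x∈ , lift-separator ¬F-B sep)
    ... | inj₂ L = inj₂ (extend L)

  -- Menger's theorem for two paths, with the two paths thickened to a partition of S.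
  separator-or-linkage : ∀ S {A B} → Decidable A → Decidable B → Connected-set S → Meets S A →
    (∃[ x ] (x ∈ S × Separates S A B x)) ⊎ Linkage S A B
  separator-or-linkage S = search S (⊂-wellFounded S)
    where
    search : ∀ S → Acc _⊂_ S → ∀ {A B} → Decidable A → Decidable B → Connected-set S → Meets S A →
             (∃[ x ] (x ∈ S × Separates S A B x)) ⊎ Linkage S A B
    search S (acc rec) {A} {B} A? B? S-conn (a , a∈S , Aa) = result
      where
      S∖a? : Decidable (λ w → w ∈ S × w ≢ a)
      S∖a? w = w ∈? S ×-dec ¬? (w ≟ a)
      S∖a : Subset n
      S∖a = comprehension S∖a?
      ∈S∖a⁺ : ∀ {w} → w ∈ S → w ≢ a → w ∈ S∖a
      ∈S∖a⁺ w∈ w≢ = ∈-comprehension⁺ S∖a? (w∈ , w≢)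
      ∈S∖a⁻ : ∀ {w} → w ∈ S∖a → w ∈ S × w ≢ a
      ∈S∖a⁻ = ∈-comprehension⁻ S∖a?
      target? : Decidable (λ w → w ∈ S∖a × B w)
      target? w = w ∈? S∖a ×-dec B? w
      reach-B = closure S∖a (comprehension target?) (proj₁ ∘ ∈-comprehension⁻ target?)
      module R = Closure reach-B

      cut-at-a : ¬ Meets R.hull A → Separates S A B a
      cut-at-a ¬meets Aa′ Bb p = ¬meets (_ , walk-target (walk-stays R.closed b∈ q) , Aa′)
        where
        q = walk-reverse (walk-mono (λ (w∈ , w≢) → ∈S∖a⁺ w∈ w≢) p)
        b∈ = R.seed⊆ (∈-comprehension⁺ target? (walk-source q , Bb))

      result : (∃[ x ] (x ∈ S × Separates S A B x)) ⊎ Linkage S A B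
      result with any? (λ a′ → a′ ∈? R.hull ×-dec A? a′)
      ... | no ¬meets = inj₁ (a , a∈S , cut-at-a ¬meets)
      -- a′ reaches B without a, so its component D in S minus a meets both A and B. The hull itself
      -- may be disconnected, and the induction requires a connected set.
      ... | yes (a′ , a′∈hull , Aa′) =
        Menger-step.split S-conn a∈S Aa D⊆S a∉D connected (λ d∈ w∈ w≢a → closed d∈ (∈S∖a⁺ w∈ w≢a))
          member Aa′ D-B B?
          (search D (rec (D⊆S , a , a∈S , a∉D)) (λ w → A? w ⊎-dec T? (adj G a w)) B? connected (a′ , member , inj₁ Aa′))
        where
        open Component (component S∖a (R.hull⊆ a′∈hull)) renaming (part to D; part⊆ to D⊆S∖a)
        D⊆S : D ⊆ S
        D⊆S = proj₁ ∘ ∈S∖a⁻ ∘ D⊆S∖a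
        a∉D : a ∉ D
        a∉D a∈D = proj₂ (∈S∖a⁻ (D⊆S∖a a∈D)) refl
        D-B : Meets D B
        D-B = let b , b∈seed , p = R.rooted a′∈hull in
          b , walk-target (walk-stays closed member (walk-mono R.hull⊆ (walk-reverse p)))
            , proj₂ (∈-comprehension⁻ target? b∈seed)

-- Cardinalities across a partition or a cut vertex.

∣disjoint-∪∣ : ∀ {n} (p q : Subset n) → (∀ {x} → x ∈ p → x ∈ q → ⊥) → ∣ p ∪ q ∣ ≡ ∣ p ∣ + ∣ q ∣
∣disjoint-∪∣ [] [] _ = refl
∣disjoint-∪∣ (inside ∷ p) (inside ∷ q) disjoint = ⊥-elim (disjoint here here)
∣disjoint-∪∣ (inside ∷ p) (outside ∷ q) disjoint =
  cong suc (∣disjoint-∪∣ p q (λ x∈p x∈q → disjoint (there x∈p) (there x∈q)))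
∣disjoint-∪∣ (outside ∷ p) (inside ∷ q) disjoint =
  trans (cong suc (∣disjoint-∪∣ p q (λ x∈p x∈q → disjoint (there x∈p) (there x∈q)))) (sym (+-suc ∣ p ∣ ∣ q ∣))
∣disjoint-∪∣ (outside ∷ p) (outside ∷ q) disjoint =
  ∣disjoint-∪∣ p q (λ x∈p x∈q → disjoint (there x∈p) (there x∈q))

record Splits {n} (S X Y : Subset n) : Set where
  field
    cover : ∀ {s} → s ∈ S → s ∈ X ⊎ s ∈ Y
    left⊆ : X ⊆ S
    right⊆ : Y ⊆ S
    disjoint : ∀ {s} → s ∈ X → s ∈ Y → ⊥

record Joint {n} (S X : Subset n) (x : Fin n) (Y : Subset n) : Set where
  field
    cover : ∀ {s} → s ∈ S → s ∈ X ⊎ s ≡ x ⊎ s ∈ Y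
    left⊆ : X ⊆ S
    joint∈ : x ∈ S
    right⊆ : Y ⊆ S
    disjoint : ∀ {s} → s ∈ X → s ∈ Y → ⊥
    joint∉left : x ∉ X
    joint∉right : x ∉ Y

splits-∣∩∣ : ∀ {n} {S X Y : Subset n} → Splits S X Y → ∀ A → ∣ A ∩ S ∣ ≡ ∣ A ∩ X ∣ + ∣ A ∩ Y ∣
splits-∣∩∣ {S = S} {X} {Y} sp A = begin
  ∣ A ∩ S ∣                   ≡⟨ cong ∣_∣ (⊆-antisym to from) ⟩
  ∣ (A ∩ X) ∪ (A ∩ Y) ∣       ≡⟨ ∣disjoint-∪∣ (A ∩ X) (A ∩ Y) (λ x∈ y∈ → disjoint (p∩q⊆q A X x∈) (p∩q⊆q A Y y∈)) ⟩
  ∣ A ∩ X ∣ + ∣ A ∩ Y ∣       ∎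
  where
  open Splits sp
  open ≡-Reasoning
  to : A ∩ S ⊆ (A ∩ X) ∪ (A ∩ Y)
  to w∈ with x∈p∩q⁻ A S w∈
  ... | w∈A , w∈S =
    [ (λ w∈X → x∈p∪q⁺ (inj₁ (x∈p∩q⁺ (w∈A , w∈X)))) , (λ w∈Y → x∈p∪q⁺ (inj₂ (x∈p∩q⁺ (w∈A , w∈Y)))) ]′ (cover w∈S)
  from : (A ∩ X) ∪ (A ∩ Y) ⊆ A ∩ S
  from w∈ with x∈p∪q⁻ (A ∩ X) (A ∩ Y) w∈
  ... | inj₁ w∈′ = let w∈A , w∈X = x∈p∩q⁻ A X w∈′ in x∈p∩q⁺ (w∈A , left⊆ w∈X)
  ... | inj₂ w∈′ = let w∈A , w∈Y = x∈p∩q⁻ A Y w∈′ in x∈p∩q⁺ (w∈A , right⊆ w∈Y)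

-- A cardinality instead of a case distinction, so that `splits-∣∩∣` for a singleton produces it
-- directly in `joint-∣∩∣`.
indicator : ∀ {n} → Subset n → Fin n → ℕ
indicator A x = ∣ A ∩ ⁅ x ⁆ ∣

indicator-∈ : ∀ {n} {A : Subset n} {x} → x ∈ A → indicator A x ≡ 1
indicator-∈ {A = A} {x} x∈ = trans (cong ∣_∣ (⊆-antisym (p∩q⊆q A ⁅ x ⁆) back)) (∣⁅x⁆∣≡1 x)
  where
  back : ⁅ x ⁆ ⊆ A ∩ ⁅ x ⁆
  back w∈ with x∈⁅y⁆⇒x≡y x w∈
  ... | refl = x∈p∩q⁺ (x∈ , w∈)

indicator-∉ : ∀ {n} {A : Subset n} {x} → x ∉ A → indicator A x ≡ 0
indicator-∉ {n} {A} {x} x∉ = trans (cong ∣_∣ (Empty-unique empty)) (∣⊥∣≡0 n)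
  where
  empty : Empty (A ∩ ⁅ x ⁆)
  empty (w , w∈) with x∈p∩q⁻ A ⁅ x ⁆ w∈
  ... | w∈A , w∈x with x∈⁅y⁆⇒x≡y x w∈x
  ... | refl = x∉ w∈A

joint-∣∩∣ : ∀ {n} {S X Y : Subset n} {x} → Joint S X x Y → ∀ A →
            ∣ A ∩ S ∣ ≡ ∣ A ∩ X ∣ + (indicator A x + ∣ A ∩ Y ∣)
joint-∣∩∣ {S = S} {X} {Y} {x} jt A = trans (splits-∣∩∣ outer A) (cong (λ z → ∣ A ∩ X ∣ + z) (splits-∣∩∣ inner A))
  where
  open Joint jt
  outer : Splits S X (⁅ x ⁆ ∪ Y)
  outer = record
    { cover = λ s∈ → [ inj₁ , inj₂ ∘ x∈p∪q⁺ ∘ [ (λ { refl → inj₁ (x∈⁅x⁆ x) }) , inj₂ ]′ ]′ (cover s∈)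
    ; left⊆ = left⊆
    ; right⊆ = λ w∈ → [ (λ w∈x → subst (_∈ S) (sym (x∈⁅y⁆⇒x≡y x w∈x)) joint∈) , right⊆ ]′ (x∈p∪q⁻ ⁅ x ⁆ Y w∈)
    ; disjoint = λ w∈X w∈ → [ (λ w∈x → joint∉left (subst (_∈ X) (x∈⁅y⁆⇒x≡y x w∈x) w∈X)) , disjoint w∈X ]′
                             (x∈p∪q⁻ ⁅ x ⁆ Y w∈) }
  inner : Splits (⁅ x ⁆ ∪ Y) ⁅ x ⁆ Y
  inner = record
    { cover = x∈p∪q⁻ ⁅ x ⁆ Y ; left⊆ = p⊆p∪q Y ; right⊆ = q⊆p∪q ⁅ x ⁆ Y
    ; disjoint = λ w∈x w∈Y → joint∉right (subst (_∈ Y) (x∈⁅y⁆⇒x≡y x w∈x) w∈Y) }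

⊆⇒∩≡ : ∀ {n} {A S : Subset n} → A ⊆ S → A ∩ S ≡ A
⊆⇒∩≡ {A = A} {S} A⊆ = ⊆-antisym (p∩q⊆p A S) (λ w∈ → x∈p∩q⁺ (w∈ , A⊆ w∈))

splits-∣∣ : ∀ {n} {S X Y : Subset n} → Splits S X Y → ∣ S ∣ ≡ ∣ X ∣ + ∣ Y ∣
splits-∣∣ {S = S} {X} {Y} sp = begin
  ∣ S ∣                   ≡⟨ cong ∣_∣ (⊆⇒∩≡ {A = S} id) ⟨
  ∣ S ∩ S ∣               ≡⟨ splits-∣∩∣ sp S ⟩
  ∣ S ∩ X ∣ + ∣ S ∩ Y ∣   ≡⟨ cong₂ _+_ (part left⊆) (part right⊆) ⟩
  ∣ X ∣ + ∣ Y ∣           ∎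
  where
  open Splits sp
  open ≡-Reasoning
  part : ∀ {X} → X ⊆ S → ∣ S ∩ X ∣ ≡ ∣ X ∣
  part {X} X⊆ = cong ∣_∣ (trans (∩-comm S X) (⊆⇒∩≡ X⊆))

joint-∣∣ : ∀ {n} {S X Y : Subset n} {x} → Joint S X x Y → ∣ S ∣ ≡ ∣ X ∣ + suc ∣ Y ∣
joint-∣∣ {S = S} {X} {Y} {x} jt = begin
  ∣ S ∣                                       ≡⟨ cong ∣_∣ (⊆⇒∩≡ {A = S} id) ⟨
  ∣ S ∩ S ∣                                   ≡⟨ joint-∣∩∣ jt S ⟩
  ∣ S ∩ X ∣ + (indicator S x + ∣ S ∩ Y ∣)     ≡⟨ cong₂ _+_ (part left⊆) (cong₂ _+_ (indicator-∈ joint∈) (part right⊆)) ⟩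
  ∣ X ∣ + suc ∣ Y ∣                           ∎
  where
  open Joint jt
  open ≡-Reasoning
  part : ∀ {X} → X ⊆ S → ∣ S ∩ X ∣ ≡ ∣ X ∣
  part {X} X⊆ = cong ∣_∣ (trans (∩-comm S X) (⊆⇒∩≡ X⊆))

-- Series-parallel networks and the lower bound.

module Networks {n : ℕ} (G : SimpleGraph n) where
  open Connectivity G public

  record Piece (S : Subset n) (u v : Fin n) : Set where
    field
      u∉ : u ∉ S
      v∉ : v ∉ S
      u≢v : u ≢ v
      boundary : ∀ {s w} → s ∈ S → s ~ w → w ∈ S ⊎ w ≡ u ⊎ w ≡ v

  -- Net u v S m: a series-parallel network with terminals u, v and interior S, |S| = 3m, all of whose
  -- u–v paths have length 1 mod 3.  Chain u v S k m: a chain of k + 1 such networks glued at k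
  -- cut vertices, |S| = k + 3m.
  data Net : Fin n → Fin n → Subset n → ℕ → Set
  data Chain : Fin n → Fin n → Subset n → ℕ → ℕ → Set

  data Net where
    edge : ∀ {u v S} → u ~ v → Empty S → Net u v S 0
    par  : ∀ {u v S X Y i j} → Piece X u v → Piece Y u v → Splits S X Y →
           Net u v X i → Net u v Y j → Net u v S (i + j)
    -- k joints separate k + 1 networks of length 1 mod 3, so the total is 1 mod 3 exactly when 3
    -- divides k; and k + 3m = 3(j + m) gives the new index.
    ser  : ∀ {u v S k m} j → k ≡ j * 3 → Chain u v S k m → Net u v S (j + m)

  data Chain where
    [_]  : ∀ {u v S m} → Net u v S m → Chain u v S 0 m
    link : ∀ {u v x S X Y k i j} → Piece S u v → Piece X u x → Piece Y x v → Joint S X x Y →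
           -- Adjacency of the terminals of a single network is allowed and not recorded. A chord
           -- from a joint x to v across further joints is excluded: it could make two chosen
           -- vertices adjacent, or give credit from outside the adjacent networks.
           (x ~ v → k ≡ 0) → Net u x X i → Chain x v Y k j → Chain u v S (suc k) (i + j)

  joint-neighbours : ∀ {S X Y : Subset n} {u v x w} → Piece S u v → Joint S X x Y → x ~ w →
                     w ≡ u ⊎ w ∈ X ⊎ w ∈ Y ⊎ w ≡ v
  joint-neighbours P jt e with Piece.boundary P (Joint.joint∈ jt) e
  ... | inj₂ (inj₁ w≡u) = inj₁ w≡u
  ... | inj₂ (inj₂ w≡v) = inj₂ (inj₂ (inj₂ w≡v))
  ... | inj₁ w∈S with Joint.cover jt w∈S
  ... | inj₁ w∈X = inj₂ (inj₁ w∈X)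
  ... | inj₂ (inj₁ refl) = contradiction refl (~-irrefl e)
  ... | inj₂ (inj₂ w∈Y) = inj₂ (inj₂ (inj₁ w∈Y))

  net-size : ∀ {u v S m} → Net u v S m → ∣ S ∣ ≡ 3 * m
  chain-size : ∀ {u v S k m} → Chain u v S k m → ∣ S ∣ ≡ k + 3 * m

  net-size (edge _ empty) = trans (cong ∣_∣ (Empty-unique empty)) (∣⊥∣≡0 n)
  net-size (par {i = i} {j} _ _ sp N N′) =
    trans (splits-∣∣ sp) (trans (cong₂ _+_ (net-size N) (net-size N′)) (sym (*-distribˡ-+ 3 i j)))
  net-size (ser {m = m} j refl C) = trans (chain-size C) (identity j m)
    where
    identity : ∀ j m → j * 3 + 3 * m ≡ 3 * (j + m)
    identity = ℕ-Solver.solve-∀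
  chain-size [ N ] = net-size N
  chain-size (link {k = k} {i} {j} _ _ _ jt _ N C) =
    trans (joint-∣∣ jt) (trans (cong₂ (λ a b → a + suc b) (net-size N) (chain-size C)) (identity i j k))
    where
    identity : ∀ i j k → 3 * i + suc (k + 3 * j) ≡ suc k + 3 * (i + j)
    identity = ℕ-Solver.solve-∀

  Dominates : Subset n → Subset n → Set
  Dominates A S = ∀ {s} → s ∈ S → s ∈ A ⊎ ∃[ w ] (w ∈ A × w ~ s)

  -- A unit that is credited for dominating the unchosen terminal x from the region R.
  data Credit (A : Subset n) (R : Pred (Fin n) 0ℓ) (x : Fin n) : ℕ → Set where
    none : Credit A R x 0
    gain : ∀ {w} → x ∉ A → w ∈ A → w ~ x → R w → Credit A R x 1

  credit-map : ∀ {A R R′ x d} → (∀ {w} → w ∈ A → w ~ x → R w → R′ w) → Credit A R x d → Credit A R′ x d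
  credit-map f none = none
  credit-map f (gain x∉ w∈ e r) = gain x∉ w∈ e (f w∈ e r)

  credit≤1 : ∀ {A R x d} → Credit A R x d → d ≤ 1
  credit≤1 none = z≤n
  credit≤1 (gain _ _ _ _) = s≤s z≤n

  credit-of-chosen : ∀ {A R x d} → x ∈ A → Credit A R x d → d ≡ 0
  credit-of-chosen _ none = refl
  credit-of-chosen x∈ (gain x∉ _ _ _) = contradiction x∈ x∉

  indicator≤1 : ∀ A (x : Fin n) → indicator A x ≤ 1
  indicator≤1 A x = subst (indicator A x ≤_) (∣⁅x⁆∣≡1 x) (∣p∩q∣≤∣q∣ A ⁅ x ⁆)

  3≤3+2⇒≤ : ∀ {m a} → 3 * m ≤ 3 * a + 2 → m ≤ a
  3≤3+2⇒≤ {m} {a} le = s≤s⁻¹ (*-cancelˡ-< 3 m (suc a) (≤-trans (s≤s le) (≤-reflexive (identity a))))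
    where
    identity : ∀ a → suc (3 * a + 2) ≡ 3 * suc a
    identity = ℕ-Solver.solve-∀

  -- The indicators add at most 2, so division by 3 gives `net-≤`. If a terminal has credit and
  -- neither is chosen, it gives m + 1. An edge satisfies it trivially, as an empty interior yields
  -- no credit.
  net-bound : ∀ {u v S m} → Net u v S m → ∀ A → Dominates A S → ∀ {d e} →
              Credit A (_∈ S) u d → Credit A (_∈ S) v e →
              3 * m + (d + e) ≤ 3 * ∣ A ∩ S ∣ + (indicator A u + indicator A v)
  -- Each joint adds 1 to the left side. For k = 0 the opposite terminal belongs to the credit
  -- region: seen from a longer chain, a joint may be dominated by the next terminal along a direct
  -- edge, and such an edge spans just one network.
  chain-bound : ∀ {u v S k m} → Chain u v S k m → ∀ A → Dominates A S → ∀ {d e} →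
                Credit A (λ w → w ∈ S ⊎ (w ≡ v × k ≡ 0)) u d → Credit A (λ w → w ∈ S ⊎ (w ≡ u × k ≡ 0)) v e →
                3 * m + k + (d + e) ≤ 3 * ∣ A ∩ S ∣ + (indicator A u + indicator A v)

  net-≤ : ∀ {u v S m} → Net u v S m → ∀ A → Dominates A S → m ≤ ∣ A ∩ S ∣
  net-≤ {u} {v} {S} {m} N A dom = 3≤3+2⇒≤ {m} {∣ A ∩ S ∣} (≤-trans (≤-reflexive (sym (+-identityʳ (3 * m))))
    (≤-trans (net-bound N A dom none none) (+-monoʳ-≤ (3 * ∣ A ∩ S ∣) (+-mono-≤ (indicator≤1 A u) (indicator≤1 A v)))))

  net-bound (edge _ empty) A _ none none = z≤n
  net-bound (edge _ empty) A _ (gain _ _ _ w∈) _ = contradiction (_ , w∈) empty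
  net-bound (edge _ empty) A _ none (gain _ _ _ w∈) = contradiction (_ , w∈) empty
  net-bound {u} {v} {S} (par {X = X} {Y} {i} {j} _ _ sp N N′) A dom {d} {e} cu cv =
    subst (λ a → 3 * (i + j) + (d + e) ≤ 3 * a + (indicator A u + indicator A v)) (sym (splits-∣∩∣ sp A)) (cases cu cv)
    where
    open Splits sp
    a = ∣ A ∩ X ∣
    b = ∣ A ∩ Y ∣
    t = indicator A u + indicator A v
    domX : Dominates A X
    domX = dom ∘ left⊆
    domY : Dominates A Y
    domY = dom ∘ right⊆
    regroup-left : ∀ i j c → 3 * (i + j) + c ≡ (3 * i + c) + 3 * j
    regroup-left = ℕ-Solver.solve-∀
    regroup-right : ∀ i j c → 3 * (i + j) + c ≡ 3 * i + (3 * j + c)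
    regroup-right = ℕ-Solver.solve-∀
    -- The branch without credit is bounded by the rounded `net-≤`, which spends no indicator; those
    -- of u and v are available only once.
    all-left : ∀ {d e} → Credit A (_∈ X) u d → Credit A (_∈ X) v e → 3 * (i + j) + (d + e) ≤ 3 * (a + b) + t
    all-left cu cv = subst₂ _≤_ (sym (regroup-left i j _)) (sym (regroup-left a b t))
      (+-mono-≤ (net-bound N A domX cu cv) (*-monoʳ-≤ 3 (net-≤ N′ A domY)))
    all-right : ∀ {d e} → Credit A (_∈ Y) u d → Credit A (_∈ Y) v e → 3 * (i + j) + (d + e) ≤ 3 * (a + b) + t
    all-right cu cv = subst₂ _≤_ (sym (regroup-right i j _)) (sym (regroup-right a b t))
      (+-mono-≤ (*-monoʳ-≤ 3 (net-≤ N A domX)) (net-bound N′ A domY cu cv))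
    regroup-both : ∀ i j c d → 3 * (i + j) + (c + d) ≡ (3 * i + c) + (3 * j + d)
    regroup-both = ℕ-Solver.solve-∀
    -- Two credits presuppose that u and v are both unchosen. All indicators are then 0 and may be
    -- charged in both branches.
    mixed : u ∉ A → v ∉ A → 3 * i + 1 ≤ 3 * a + t → 3 * j + 1 ≤ 3 * b + t → 3 * (i + j) + 2 ≤ 3 * (a + b) + t
    mixed u∉ v∉ le le′ = subst₂ _≤_ (sym (regroup-both i j 1 1))
      (trans (sym (regroup-both a b t t)) (cong (λ t → 3 * (a + b) + t) (trans (cong₂ _+_ t≡0 t≡0) (sym t≡0))))
      (+-mono-≤ le le′)
      where
      t≡0 : t ≡ 0
      t≡0 = cong₂ _+_ (indicator-∉ u∉) (indicator-∉ v∉)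
    cases : ∀ {d e} → Credit A (_∈ S) u d → Credit A (_∈ S) v e → 3 * (i + j) + (d + e) ≤ 3 * (a + b) + t
    cases none none = all-left none none
    cases none (gain v∉ w∈A w~v w∈) with cover w∈
    ... | inj₁ w∈X = all-left none (gain v∉ w∈A w~v w∈X)
    ... | inj₂ w∈Y = all-right none (gain v∉ w∈A w~v w∈Y)
    cases (gain u∉ w∈A w~u w∈) none with cover w∈
    ... | inj₁ w∈X = all-left (gain u∉ w∈A w~u w∈X) none
    ... | inj₂ w∈Y = all-right (gain u∉ w∈A w~u w∈Y) none
    cases (gain u∉ w∈A w~u w∈) (gain v∉ z∈A z~v z∈) with cover w∈ | cover z∈
    ... | inj₁ w∈X | inj₁ z∈X = all-left (gain u∉ w∈A w~u w∈X) (gain v∉ z∈A z~v z∈X)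
    ... | inj₂ w∈Y | inj₂ z∈Y = all-right (gain u∉ w∈A w~u w∈Y) (gain v∉ z∈A z~v z∈Y)
    ... | inj₁ w∈X | inj₂ z∈Y = mixed u∉ v∉
      (net-bound N A domX (gain u∉ w∈A w~u w∈X) none) (net-bound N′ A domY none (gain v∉ z∈A z~v z∈Y))
    ... | inj₂ w∈Y | inj₁ z∈X = mixed u∉ v∉
      (net-bound N A domX none (gain v∉ z∈A z~v z∈X)) (net-bound N′ A domY (gain u∉ w∈A w~u w∈Y) none)
  net-bound {u} {v} {S} (ser {m = m} j refl C) A dom {d} {e} cu cv =
    subst (λ l → l + (d + e) ≤ 3 * ∣ A ∩ S ∣ + (indicator A u + indicator A v)) (identity m j)
      (chain-bound C A dom (credit-map (λ _ _ → inj₁) cu) (credit-map (λ _ _ → inj₁) cv))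
    where
    identity : ∀ m j → 3 * m + j * 3 ≡ 3 * (j + m)
    identity = ℕ-Solver.solve-∀

  chain-bound {u} {v} {S} {m = m} [ N ] A dom {d} {e} cu cv =
    subst (λ l → l + (d + e) ≤ 3 * a + (indicator A u + indicator A v)) (sym (+-identityʳ (3 * m))) (cases cu cv)
    where
    a = ∣ A ∩ S ∣
    -- A terminal dominated by the other one is paid for by the indicator of the latter.
    paid : ∀ {d e} → 1 ≤ indicator A u + indicator A v → d + e ≤ 1 →
           3 * m + (d + e) ≤ 3 * a + (indicator A u + indicator A v)
    paid 1≤ ≤1 = +-mono-≤ (*-monoʳ-≤ 3 (net-≤ N A dom)) (≤-trans ≤1 1≤)
    cases : ∀ {d e} → Credit A _ u d → Credit A _ v e →
            3 * m + (d + e) ≤ 3 * a + (indicator A u + indicator A v)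
    cases {e = e} (gain {w} u∉ w∈A w~u (inj₂ (refl , _))) cv = paid {1} {e}
      (≤-trans (≤-reflexive (sym (indicator-∈ w∈A))) (m≤n+m _ (indicator A u)))
      (≤-reflexive (cong suc (credit-of-chosen w∈A cv)))
    cases {d} cu (gain {w} v∉ w∈A w~v (inj₂ (refl , _))) = paid {d} {1}
      (≤-trans (≤-reflexive (sym (indicator-∈ w∈A))) (m≤m+n _ (indicator A v)))
      (≤-reflexive (cong (_+ 1) (credit-of-chosen w∈A cu)))
    cases none none = net-bound N A dom none none
    cases none (gain v∉ w∈A w~v (inj₁ w∈)) = net-bound N A dom none (gain v∉ w∈A w~v w∈)
    cases (gain u∉ w∈A w~u (inj₁ w∈)) none = net-bound N A dom (gain u∉ w∈A w~u w∈) none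
    cases (gain u∉ w∈A w~u (inj₁ w∈)) (gain v∉ z∈A z~v (inj₁ z∈)) =
      net-bound N A dom (gain u∉ w∈A w~u w∈) (gain v∉ z∈A z~v z∈)
  chain-bound {u} {v} {S} (link {x = x} {X = X} {Y} {k} {i} {j} P PX PY jt simple N C) A dom {d} {e} cu cv =
    subst (λ a → 3 * (i + j) + suc k + (d + e) ≤ 3 * a + (indicator A u + indicator A v))
      (sym (joint-∣∩∣ jt A)) (cases (x ∈? A))
    where
    open Joint jt
    a = ∣ A ∩ X ∣
    b = ∣ A ∩ Y ∣
    ιu = indicator A u
    ιv = indicator A v
    ιx = indicator A x
    domX : Dominates A X
    domX = dom ∘ left⊆
    domY : Dominates A Y
    domY = dom ∘ right⊆

    u∉Y : ∀ {w} → w ∈ Y → ¬ (w ~ u)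
    u∉Y w∈ e with Piece.boundary PY w∈ e
    ... | inj₁ u∈ = Piece.u∉ P (right⊆ u∈)
    ... | inj₂ (inj₁ u≡x) = Piece.u≢v PX u≡x
    ... | inj₂ (inj₂ u≡v) = Piece.u≢v P u≡v
    v∉X : ∀ {w} → w ∈ X → ¬ (w ~ v)
    v∉X w∈ e with Piece.boundary PX w∈ e
    ... | inj₁ v∈ = Piece.v∉ P (left⊆ v∈)
    ... | inj₂ (inj₁ v≡u) = Piece.u≢v P (sym v≡u)
    ... | inj₂ (inj₂ v≡x) = Piece.u≢v PY (sym v≡x)

    cv′ : Credit A (λ w → w ∈ Y ⊎ (w ≡ x × k ≡ 0)) v e
    cv′ = credit-map locate cv
      where
      locate : ∀ {w} → w ∈ A → w ~ v → w ∈ S ⊎ (w ≡ u × suc k ≡ 0) → w ∈ Y ⊎ (w ≡ x × k ≡ 0)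
      locate _ w~v (inj₁ w∈) with cover w∈
      ... | inj₁ w∈X = contradiction w~v (v∉X w∈X)
      ... | inj₂ (inj₁ refl) = inj₂ (refl , simple w~v)
      ... | inj₂ (inj₂ w∈Y) = inj₁ w∈Y

    cu′ : x ∉ A → Credit A (_∈ X) u d
    cu′ x∉ = credit-map locate cu
      where
      locate : ∀ {w} → w ∈ A → w ~ u → w ∈ S ⊎ (w ≡ v × suc k ≡ 0) → w ∈ X
      locate w∈A w~u (inj₁ w∈) with cover w∈
      ... | inj₁ w∈X = w∈X
      ... | inj₂ (inj₁ refl) = contradiction w∈A x∉
      ... | inj₂ (inj₂ w∈Y) = contradiction w~u (u∉Y w∈Y)

    Goal : Set
    Goal = 3 * (i + j) + suc k + (d + e) ≤ 3 * (a + (ιx + b)) + (ιu + ιv)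

    -- The 3 units of x pay for the joint, for the indicator of x in the remaining chain, and for
    -- the credit at u, which may be due to x itself. Hence `net-≤` suffices on X.
    chosen : x ∈ A → Goal
    chosen x∈ = subst (λ ι → 3 * (i + j) + suc k + (d + e) ≤ 3 * (a + (ι + b)) + (ιu + ιv)) (sym ιx≡1)
      (subst₂ _≤_ (left i j k d e) (right a b ιu ιv)
        (+-mono-≤ (+-mono-≤ {3 * i + d} {3 * a + (1 + ιu)}
          (+-mono-≤ (*-monoʳ-≤ 3 (net-≤ N A domX)) (≤-trans (credit≤1 cu) (m≤m+n 1 ιu)))
          (subst (λ ι → 3 * j + k + e ≤ 3 * b + (ι + ιv)) ιx≡1 (chain-bound C A domY none cv′))) (≤-refl {1})))
      where
      ιx≡1 = indicator-∈ x∈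
      left : ∀ i j k d e → 3 * i + d + (3 * j + k + e) + 1 ≡ 3 * (i + j) + suc k + (d + e)
      left = ℕ-Solver.solve-∀
      right : ∀ a b u v → 3 * a + (1 + u) + (3 * b + (1 + v)) + 1 ≡ 3 * (a + (1 + b)) + (u + v)
      right = ℕ-Solver.solve-∀

    -- When x is dominated from X, or from Y or v, its credit on that side accounts for the joint.
    unchosen : x ∉ A → ∀ {d₁ d₂} → Credit A (_∈ X) x d₁ → Credit A (λ w → w ∈ Y ⊎ (w ≡ v × k ≡ 0)) x d₂ →
               3 * i + (d + d₁) + (3 * j + k + (d₂ + e)) ≤ 3 * (a + (ιx + b)) + (ιu + ιv)
    unchosen x∉ {d₁} {d₂} c₁ c₂ = subst (λ ι → _ ≤ 3 * (a + (ι + b)) + (ιu + ιv)) (sym ιx≡0)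
      (≤-trans (+-mono-≤ (net-bound N A domX (cu′ x∉) c₁) (chain-bound C A domY c₂ cv′))
        (≤-reflexive (trans (cong (λ ι → 3 * a + (ιu + ι) + (3 * b + (ι + ιv))) ιx≡0) (right a b ιu ιv))))
      where
      ιx≡0 = indicator-∉ x∉
      right : ∀ a b u v → 3 * a + (u + 0) + (3 * b + (0 + v)) ≡ 3 * (a + (0 + b)) + (u + v)
      right = ℕ-Solver.solve-∀

    cases : Dec (x ∈ A) → Goal
    cases (yes x∈) = chosen x∈
    cases (no x∉) with dom joint∈
    ... | inj₁ x∈ = contradiction x∈ x∉
    ... | inj₂ (w , w∈ , w~x) with joint-neighbours P jt (~-sym w~x)
    ... | inj₂ (inj₁ w∈X) = ≤-trans (≤-reflexive (regroup i j k d e)) (unchosen x∉ (gain x∉ w∈ w~x w∈X) none)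
      where
      regroup : ∀ i j k d e → 3 * (i + j) + suc k + (d + e) ≡ 3 * i + (d + 1) + (3 * j + k + (0 + e))
      regroup = ℕ-Solver.solve-∀
    ... | inj₂ (inj₂ w∈Yv) = ≤-trans (≤-reflexive (regroup i j k d e)) (unchosen x∉ none (gain x∉ w∈ w~x (region w∈Yv)))
      where
      region : w ∈ Y ⊎ w ≡ v → w ∈ Y ⊎ (w ≡ v × k ≡ 0)
      region (inj₁ w∈Y) = inj₁ w∈Y
      region (inj₂ refl) = inj₂ (refl , simple (~-sym w~x))
      regroup : ∀ i j k d e → 3 * (i + j) + suc k + (d + e) ≡ 3 * i + (d + 0) + (3 * j + k + (1 + e))
      regroup = ℕ-Solver.solve-∀
    -- Here u dominates x. Being chosen, u has no credit, and its indicator, left unspent by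
    -- `net-≤`, pays for the joint.
    ... | inj₁ refl = subst₂ _≤_ lhs rhs
      (+-mono-≤ (+-mono-≤ (*-monoʳ-≤ 3 (net-≤ N A domX)) (chain-bound C A domY none cv′)) (≤-refl {1}))
      where
      regroup : ∀ i j k e → 3 * i + (3 * j + k + e) + 1 ≡ 3 * (i + j) + suc k + (0 + e)
      regroup = ℕ-Solver.solve-∀
      regroup′ : ∀ a b v → 3 * a + (3 * b + (0 + v)) + 1 ≡ 3 * (a + (0 + b)) + (1 + v)
      regroup′ = ℕ-Solver.solve-∀
      lhs : 3 * i + (3 * j + k + e) + 1 ≡ 3 * (i + j) + suc k + (d + e)
      lhs = trans (regroup i j k e) (cong (λ d → 3 * (i + j) + suc k + (d + e)) (sym (credit-of-chosen w∈ cu)))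
      rhs : 3 * a + (3 * b + (ιx + ιv)) + 1 ≡ 3 * (a + (ιx + b)) + (ιu + ιv)
      rhs = trans (cong (λ ι → 3 * a + (3 * b + (ι + ιv)) + 1) (indicator-∉ x∉)) (trans (regroup′ a b ιv)
        (cong₂ (λ ι κ → 3 * (a + (ι + b)) + (κ + ιv)) (sym (indicator-∉ x∉)) (sym (indicator-∈ w∈))))

-- Minimum independent dominating sets of networks.

-- Along a chain every third terminal is chosen; the others are dominated from
-- the preceding side (served) or from the following side (pending).
data Role : Set where
  chosen served pending : Role

next : Role → Role
next chosen = served
next served = pending
next pending = chosen

shift : ℕ → Role → Role
shift zero r = next r
shift (suc k) r = shift k (next r)

cost : Role → ℕ
cost chosen = 1
cost served = 0
cost pending = 0

chosen-joints : ℕ → Role → ℕ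
chosen-joints zero r = 0
chosen-joints (suc k) r = cost (next r) + chosen-joints k (next r)

shift-*3 : ∀ j r → shift (j * 3) r ≡ next r
shift-*3 zero r = refl
shift-*3 (suc j) chosen = shift-*3 j chosen
shift-*3 (suc j) served = shift-*3 j served
shift-*3 (suc j) pending = shift-*3 j pending

-- `next` has order 3, so exactly one of three consecutive joints is chosen, whatever the first
-- role. This accounts for the summand j in the index of `ser`.
chosen-joints-*3 : ∀ j r → chosen-joints (j * 3) r ≡ j
chosen-joints-*3 zero r = refl
chosen-joints-*3 (suc j) chosen = cong suc (chosen-joints-*3 j chosen)
chosen-joints-*3 (suc j) served = cong suc (chosen-joints-*3 j served)
chosen-joints-*3 (suc j) pending = cong suc (chosen-joints-*3 j pending)

module Constructions {n : ℕ} (G : SimpleGraph n) where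
  open Networks G public

  Chosen : Subset n → Fin n → Fin n → Role → Role → Fin n → Set
  Chosen A u v r s w = w ∈ A ⊎ (w ≡ u × r ≡ chosen) ⊎ (w ≡ v × s ≡ chosen)

  -- Terminals are assumed to follow their roles and are added to the set only on gluing. A served u
  -- is dominated before the network and a pending v after it, so only `pending-u` and `served-v`
  -- are owed inside. That two chosen terminals are not adjacent is left to the gluing.
  record Solution (u v : Fin n) (S : Subset n) (r s : Role) (m : ℕ) : Set where
    field
      A : Subset n
      A⊆S : A ⊆ S
      size : ∣ A ∣ ≡ m
      independent : ∀ {a w} → a ∈ A → Chosen A u v r s w → ¬ (a ~ w)
      dominating : ∀ {x} → x ∈ S → x ∈ A ⊎ ∃[ w ] (Chosen A u v r s w × w ~ x)
      pending-u : r ≡ pending → ∃[ w ] (Chosen A u v r s w × w ~ u)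
      served-v : s ≡ served → ∃[ w ] (Chosen A u v r s w × w ~ v)

  edge-solution : ∀ {u v S} → u ~ v → Empty S → ∀ r → Solution u v S r (next r) 0
  edge-solution u~v empty r = record
    { A = ∅ ; A⊆S = λ a∈ → contradiction a∈ ∉⊥ ; size = ∣⊥∣≡0 n
    ; independent = λ a∈ → contradiction a∈ ∉⊥
    ; dominating = λ x∈ → contradiction (_ , x∈) empty
    ; pending-u = λ { refl → _ , inj₂ (inj₂ (refl , refl)) , ~-sym u~v }
    ; served-v = λ eq → _ , inj₂ (inj₁ (refl , served⇒chosen r eq)) , u~v }
    where
    served⇒chosen : ∀ r → next r ≡ served → r ≡ chosen
    served⇒chosen chosen _ = refl

  par-solution : ∀ {u v S X Y r s i j} → Piece X u v → Piece Y u v → Splits S X Y →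
    Solution u v X r s i → Solution u v Y r s j → Solution u v S r s (i + j)
  par-solution {u} {v} {S} {X} {Y} {r} {s} PX PY sp σ τ = record
    { A = A ; A⊆S = λ a∈ → [ Sp.left⊆ ∘ L.A⊆S , Sp.right⊆ ∘ R.A⊆S ]′ (x∈p∪q⁻ L.A R.A a∈)
    ; size = trans (∣disjoint-∪∣ L.A R.A (λ x∈ y∈ → Sp.disjoint (L.A⊆S x∈) (R.A⊆S y∈))) (cong₂ _+_ L.size R.size)
    ; independent = λ a∈ → indep (x∈p∪q⁻ L.A R.A a∈) ∘ locate
    ; dominating = λ x∈ → dominate (Sp.cover x∈)
    ; pending-u = λ eq → let w , c , e = L.pending-u eq in w , from-left c , e
    ; served-v = λ eq → let w , c , e = L.served-v eq in w , from-left c , e }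
    where
    module L = Solution σ
    module R = Solution τ
    module Sp = Splits sp
    A : Subset n
    A = L.A ∪ R.A
    from-left : ∀ {w} → Chosen L.A u v r s w → Chosen A u v r s w
    from-left = [ inj₁ ∘ x∈p∪q⁺ ∘ inj₁ , inj₂ ]′
    from-right : ∀ {w} → Chosen R.A u v r s w → Chosen A u v r s w
    from-right = [ inj₁ ∘ x∈p∪q⁺ ∘ inj₂ , inj₂ ]′
    locate : ∀ {w} → Chosen A u v r s w → Chosen L.A u v r s w ⊎ w ∈ R.A
    locate (inj₁ w∈) = [ inj₁ ∘ inj₁ , inj₂ ]′ (x∈p∪q⁻ L.A R.A w∈)
    locate (inj₂ end) = inj₁ (inj₂ end)
    no-edge : ∀ {x y} → x ∈ X → y ∈ Y → ¬ (x ~ y)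
    no-edge x∈ y∈ e with Piece.boundary PX x∈ e
    ... | inj₁ y∈X = Sp.disjoint y∈X y∈
    ... | inj₂ (inj₁ refl) = Piece.u∉ PY y∈
    ... | inj₂ (inj₂ refl) = Piece.v∉ PY y∈
    indep : ∀ {a w} → a ∈ L.A ⊎ a ∈ R.A → Chosen L.A u v r s w ⊎ w ∈ R.A → ¬ (a ~ w)
    indep (inj₁ a∈) (inj₁ c) = L.independent a∈ c
    indep (inj₁ a∈) (inj₂ w∈) = no-edge (L.A⊆S a∈) (R.A⊆S w∈)
    indep (inj₂ a∈) (inj₁ (inj₁ w∈)) = no-edge (L.A⊆S w∈) (R.A⊆S a∈) ∘ ~-sym
    indep (inj₂ a∈) (inj₁ (inj₂ end)) = R.independent a∈ (inj₂ end)
    indep (inj₂ a∈) (inj₂ w∈) = R.independent a∈ (inj₁ w∈)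
    dominate : ∀ {x} → x ∈ X ⊎ x ∈ Y → x ∈ A ⊎ ∃[ w ] (Chosen A u v r s w × w ~ x)
    dominate (inj₁ x∈) = [ inj₁ ∘ x∈p∪q⁺ ∘ inj₁ , (λ (w , c , e) → inj₂ (w , from-left c , e)) ]′ (L.dominating x∈)
    dominate (inj₂ x∈) = [ inj₁ ∘ x∈p∪q⁺ ∘ inj₂ , (λ (w , c , e) → inj₂ (w , from-right c , e)) ]′ (R.dominating x∈)

  core : Role → Fin n → Subset n
  core chosen x = ⁅ x ⁆
  core served x = ∅
  core pending x = ∅

  ∣core∣ : ∀ r x → ∣ core r x ∣ ≡ cost r
  ∣core∣ chosen x = ∣⁅x⁆∣≡1 x
  ∣core∣ served x = ∣⊥∣≡0 n
  ∣core∣ pending x = ∣⊥∣≡0 n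

  ∈core⁻ : ∀ r x {w} → w ∈ core r x → w ≡ x × r ≡ chosen
  ∈core⁻ chosen x w∈ = x∈⁅y⁆⇒x≡y x w∈ , refl
  ∈core⁻ served x w∈ = contradiction w∈ ∉⊥
  ∈core⁻ pending x w∈ = contradiction w∈ ∉⊥

  joint-solution : ∀ {u v x S X Y r s t i j} → Piece S u v → Piece X u x → Piece Y x v → Joint S X x Y →
    (r ≡ chosen → s ≡ chosen → ¬ (x ~ u)) → (s ≡ chosen → t ≡ chosen → ¬ (x ~ v)) →
    Solution u x X r s i → Solution x v Y s t j → Solution u v S r t (i + (cost s + j))
  joint-solution {u} {v} {x} {S} {X} {Y} {r} {s} {t} P PX PY jt no-xu no-xv σ τ = record
    { A = A ; A⊆S = λ a∈ → part-of (parts a∈)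
    ; size = trans (∣disjoint-∪∣ L.A (core s x ∪ R.A) disjoint₁) (cong₂ _+_ L.size
        (trans (∣disjoint-∪∣ (core s x) R.A disjoint₂) (cong₂ _+_ (∣core∣ s x) R.size)))
    ; independent = λ a∈ → indep (parts a∈)
    ; dominating = λ y∈ → dominate (J.cover y∈)
    ; pending-u = λ eq → let w , c , e = L.pending-u eq in w , from-left c , e
    ; served-v = λ eq → let w , c , e = R.served-v eq in w , from-right c , e }
    where
    module L = Solution σ
    module R = Solution τ
    module J = Joint jt
    A : Subset n
    A = L.A ∪ (core s x ∪ R.A)
    Parts : Fin n → Set
    Parts w = w ∈ L.A ⊎ (w ≡ x × s ≡ chosen) ⊎ w ∈ R.A
    parts : ∀ {w} → w ∈ A → Parts w
    parts w∈ = [ inj₁ , inj₂ ∘ [ inj₁ ∘ ∈core⁻ s x , inj₂ ]′ ∘ x∈p∪q⁻ (core s x) R.A ]′ (x∈p∪q⁻ L.A (core s x ∪ R.A) w∈)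
    part-of : ∀ {w} → Parts w → w ∈ S
    part-of (inj₁ w∈) = J.left⊆ (L.A⊆S w∈)
    part-of (inj₂ (inj₁ (refl , _))) = J.joint∈
    part-of (inj₂ (inj₂ w∈)) = J.right⊆ (R.A⊆S w∈)
    left∈ : ∀ {w} → w ∈ L.A → w ∈ A
    left∈ w∈ = x∈p∪q⁺ (inj₁ w∈)
    right∈ : ∀ {w} → w ∈ R.A → w ∈ A
    right∈ w∈ = x∈p∪q⁺ (inj₂ (x∈p∪q⁺ (inj₂ w∈)))
    joint∈ : s ≡ chosen → x ∈ A
    joint∈ refl = x∈p∪q⁺ (inj₂ (x∈p∪q⁺ (inj₁ (x∈⁅x⁆ x))))
    disjoint₂ : ∀ {w} → w ∈ core s x → w ∈ R.A → ⊥
    disjoint₂ w∈ w∈R with ∈core⁻ s x w∈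
    ... | refl , _ = J.joint∉right (R.A⊆S w∈R)
    disjoint₁ : ∀ {w} → w ∈ L.A → w ∈ core s x ∪ R.A → ⊥
    disjoint₁ w∈L w∈ with x∈p∪q⁻ (core s x) R.A w∈
    ... | inj₂ w∈R = J.disjoint (L.A⊆S w∈L) (R.A⊆S w∈R)
    ... | inj₁ w∈x with ∈core⁻ s x w∈x
    ... | refl , _ = J.joint∉left (L.A⊆S w∈L)
    from-left : ∀ {w} → Chosen L.A u x r s w → Chosen A u v r t w
    from-left (inj₁ w∈) = inj₁ (left∈ w∈)
    from-left (inj₂ (inj₁ w≡u)) = inj₂ (inj₁ w≡u)
    from-left (inj₂ (inj₂ (refl , s≡))) = inj₁ (joint∈ s≡)
    from-right : ∀ {w} → Chosen R.A x v s t w → Chosen A u v r t w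
    from-right (inj₁ w∈) = inj₁ (right∈ w∈)
    from-right (inj₂ (inj₁ (refl , s≡))) = inj₁ (joint∈ s≡)
    from-right (inj₂ (inj₂ w≡v)) = inj₂ (inj₂ w≡v)
    X≁Y : ∀ {a b} → a ∈ X → b ∈ Y → ¬ (a ~ b)
    X≁Y a∈ b∈ e with Piece.boundary PX a∈ e
    ... | inj₁ b∈X = J.disjoint b∈X b∈
    ... | inj₂ (inj₁ refl) = Piece.u∉ P (J.right⊆ b∈)
    ... | inj₂ (inj₂ refl) = J.joint∉right b∈
    X≁v : ∀ {a} → a ∈ X → ¬ (a ~ v)
    X≁v a∈ e with Piece.boundary PX a∈ e
    ... | inj₁ v∈X = Piece.v∉ P (J.left⊆ v∈X)
    ... | inj₂ (inj₁ v≡u) = Piece.u≢v P (sym v≡u)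
    ... | inj₂ (inj₂ v≡x) = Piece.u≢v PY (sym v≡x)
    Y≁u : ∀ {a} → a ∈ Y → ¬ (a ~ u)
    Y≁u a∈ e with Piece.boundary PY a∈ e
    ... | inj₁ u∈Y = Piece.u∉ P (J.right⊆ u∈Y)
    ... | inj₂ (inj₁ u≡x) = Piece.u≢v PX u≡x
    ... | inj₂ (inj₂ u≡v) = Piece.u≢v P u≡v
    indep : ∀ {a w} → Parts a → Chosen A u v r t w → ¬ (a ~ w)
    indep a (inj₁ w∈) = inner a (parts w∈)
      where
      inner : ∀ {a w} → Parts a → Parts w → ¬ (a ~ w)
      inner (inj₁ a∈) (inj₁ w∈) = L.independent a∈ (inj₁ w∈)
      inner (inj₁ a∈) (inj₂ (inj₁ w≡x)) = L.independent a∈ (inj₂ (inj₂ w≡x))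
      inner (inj₁ a∈) (inj₂ (inj₂ w∈)) = X≁Y (L.A⊆S a∈) (R.A⊆S w∈)
      inner (inj₂ (inj₁ a≡x)) (inj₁ w∈) = L.independent w∈ (inj₂ (inj₂ a≡x)) ∘ ~-sym
      inner (inj₂ (inj₁ (refl , _))) (inj₂ (inj₁ (refl , _))) = λ e → ~-irrefl e refl
      inner (inj₂ (inj₁ a≡x)) (inj₂ (inj₂ w∈)) = R.independent w∈ (inj₂ (inj₁ a≡x)) ∘ ~-sym
      inner (inj₂ (inj₂ a∈)) (inj₁ w∈) = X≁Y (L.A⊆S w∈) (R.A⊆S a∈) ∘ ~-sym
      inner (inj₂ (inj₂ a∈)) (inj₂ (inj₁ w≡x)) = R.independent a∈ (inj₂ (inj₁ w≡x))
      inner (inj₂ (inj₂ a∈)) (inj₂ (inj₂ w∈)) = R.independent a∈ (inj₁ w∈)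
    indep (inj₁ a∈) (inj₂ (inj₁ w≡u)) = L.independent a∈ (inj₂ (inj₁ w≡u))
    indep (inj₂ (inj₁ (refl , s≡))) (inj₂ (inj₁ (refl , r≡))) = no-xu r≡ s≡
    indep (inj₂ (inj₂ a∈)) (inj₂ (inj₁ (refl , _))) = Y≁u (R.A⊆S a∈)
    indep (inj₁ a∈) (inj₂ (inj₂ (refl , _))) = X≁v (L.A⊆S a∈)
    indep (inj₂ (inj₁ (refl , s≡))) (inj₂ (inj₂ (refl , t≡))) = no-xv s≡ t≡
    indep (inj₂ (inj₂ a∈)) (inj₂ (inj₂ w≡v)) = R.independent a∈ (inj₂ (inj₂ w≡v))
    Dominated : Fin n → Set
    Dominated y = y ∈ A ⊎ ∃[ w ] (Chosen A u v r t w × w ~ y)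
    dominate-joint : ∀ s′ → s ≡ s′ → Dominated x
    dominate-joint chosen s≡ = inj₁ (joint∈ s≡)
    dominate-joint served s≡ = let w , c , e = L.served-v s≡ in inj₂ (w , from-left c , e)
    dominate-joint pending s≡ = let w , c , e = R.pending-u s≡ in inj₂ (w , from-right c , e)
    dominate : ∀ {y} → y ∈ X ⊎ y ≡ x ⊎ y ∈ Y → Dominated y
    dominate (inj₁ y∈) = [ inj₁ ∘ left∈ , (λ (w , c , e) → inj₂ (w , from-left c , e)) ]′ (L.dominating y∈)
    dominate (inj₂ (inj₁ refl)) = dominate-joint s refl
    dominate (inj₂ (inj₂ y∈)) = [ inj₁ ∘ right∈ , (λ (w , c , e) → inj₂ (w , from-right c , e)) ]′ (R.dominating y∈)

  net-solution : ∀ {u v S m} → Net u v S m → ∀ r → Solution u v S r (next r) m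
  chain-solution : ∀ {u v S k m} → Chain u v S k m → ∀ r → Solution u v S r (shift k r) (chosen-joints k r + m)

  net-solution (edge u~v empty) r = edge-solution u~v empty r
  net-solution (par PX PY sp N N′) r = par-solution PX PY sp (net-solution N r) (net-solution N′ r)
  net-solution {u} {v} {S} (ser {m = m} j refl C) r =
    subst₂ (λ s c → Solution u v S r s (c + m)) (shift-*3 j r) (chosen-joints-*3 j r) (chain-solution C r)
  chain-solution [ N ] r = net-solution N r
  chain-solution {u} {v} {S} (link {x = x} {k = k} {i} {j} P PX PY jt simple N C) r =
    subst (Solution u v S r (shift k (next r))) (regroup i (cost (next r)) (chosen-joints k (next r)) j)
      (joint-solution P PX PY jt (λ { refl () }) no-xv (net-solution N r) (chain-solution C (next r)))
    where
    regroup : ∀ i c d j → i + (c + (d + j)) ≡ c + d + (i + j)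
    regroup = ℕ-Solver.solve-∀
    -- An edge from x to v leaves a single network between them, and consecutive roles differ.
    -- Across three networks both could be chosen, which is where the condition in `link` is used.
    no-xv : next r ≡ chosen → shift k (next r) ≡ chosen → ¬ (x ~ v)
    no-xv r≡ s≡ e with simple e
    ... | refl with trans (cong next (sym r≡)) s≡
    ... | ()

-- Consequences of the residue 2.

multiple-of-3 : ∀ k {z} → pos k ≡ z ℤ.* pos 3 → ∃[ j ] (k ≡ j * 3)
multiple-of-3 k {z} eq with ℤ∣.∣⇒∣ᵤ (ℤ∣.divides z eq)
... | ℕ∣.divides j k≡ = j , k≡

-- From 2k + 2 = 2 + 3q follows k = 3k - 2k = 3(k - q), the witness used below.
Two-double : ∀ k → Two (suc k + suc k) → ∃[ j ] (k ≡ j * 3)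
Two-double k (q , eq) = multiple-of-3 k {pos k ℤ.- q} (trans (halve (pos k) q) (trans
    (cong (λ z → (pos k ℤ.- q) ℤ.* pos 3 ℤ.+ (pos 2 ℤ.+ pos 3 ℤ.* q ℤ.- z)) (trans (double (pos k)) eq))
    (cancel ((pos k ℤ.- q) ℤ.* pos 3) (pos 2 ℤ.+ pos 3 ℤ.* q))))
  where
  double : ∀ k → pos 2 ℤ.+ k ℤ.+ k ≡ (pos 1 ℤ.+ k) ℤ.+ (pos 1 ℤ.+ k)
  double = ℤ-Solver.solve-∀
  halve : ∀ k q → k ≡ (k ℤ.- q) ℤ.* pos 3 ℤ.+ (pos 2 ℤ.+ pos 3 ℤ.* q ℤ.- (pos 2 ℤ.+ k ℤ.+ k))
  halve = ℤ-Solver.solve-∀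
  cancel : ∀ x y → x ℤ.+ (y ℤ.- y) ≡ x
  cancel = ℤ-Solver.solve-∀

Two-suc+1 : ∀ k → Two (suc k + 1) → ∃[ j ] (k ≡ j * 3)
Two-suc+1 k (q , eq) = multiple-of-3 k {q} (trans (split (pos k)) (trans (cong (ℤ._- pos 2) eq) (drop q)))
  where
  split : ∀ k → k ≡ ((pos 1 ℤ.+ k) ℤ.+ pos 1) ℤ.- pos 2
  split = ℤ-Solver.solve-∀
  drop : ∀ q → (pos 2 ℤ.+ pos 3 ℤ.* q) ℤ.- pos 2 ≡ q ℤ.* pos 3
  drop = ℤ-Solver.solve-∀

Two-reduce : ∀ j o → Two (suc (j * 3) + o) → Two (1 + o)
Two-reduce j o (q , eq) = q ℤ.- pos j , trans (split (pos o) (pos j)) (trans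
  (cong (ℤ._- pos j ℤ.* pos 3) (trans (cong (λ z → pos 1 ℤ.+ z ℤ.+ pos o) (sym (ℤ.pos-* j 3))) eq)) (merge q (pos j)))
  where
  split : ∀ o j → pos 1 ℤ.+ o ≡ ((pos 1 ℤ.+ j ℤ.* pos 3) ℤ.+ o) ℤ.- j ℤ.* pos 3
  split = ℤ-Solver.solve-∀
  merge : ∀ q j → (pos 2 ℤ.+ pos 3 ℤ.* q) ℤ.- j ℤ.* pos 3 ≡ pos 2 ℤ.+ pos 3 ℤ.* (q ℤ.- j)
  merge = ℤ-Solver.solve-∀

-- Decomposition of a piece with two terminals into networks.

module Decomposition {n : ℕ} (G : SimpleGraph n) where
  open Constructions G public

  swap-piece : ∀ {S u v} → Piece S u v → Piece S v u
  swap-piece P = record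
    { u∉ = v∉ ; v∉ = u∉ ; u≢v = ≢-sym u≢v
    ; boundary = λ s∈ e → [ inj₁ , inj₂ ∘ [ inj₂ , inj₁ ]′ ]′ (boundary s∈ e) }
    where open Piece P

  -- `link` extends a chain only at the u end, so the recursion runs over the first chain, and
  -- everything after its first joint y must again be a piece. If the first chain has a joint, x is
  -- not adjacent to u; otherwise that remainder would have u as a third boundary vertex.
  chain-append : ∀ {S X Y u v x k l i j} → Piece S u v → Piece X u x → Piece Y x v → Joint S X x Y →
    (x ~ u → k ≡ 0) → (x ~ v → l ≡ 0) → Chain u x X k i → Chain x v Y l j → Chain u v S (k + suc l) (i + j)
  chain-append P PX PY jt _ x~v [ N ] D = link P PX PY jt x~v N D
  chain-append {S} {X} {Y} {u} {v} {x} {l = l} {j = j} P PX PY jt x~u x~v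
               (link {x = y} {X = X₁} {Y = X₂} {k = k} {i = i₁} {j = i₂} _ PX₁ PX₂ jt₁ simple N C) D =
    subst (Chain u v S _) (sym (+-assoc i₁ i₂ j))
      (link P PX₁ PR jtR (λ e → contradiction e (X≁v I.joint∈)) N
        (chain-append PR PX₂ PY jtR′ (simple ∘ ~-sym) x~v C D))
    where
    module J = Joint jt
    module I = Joint jt₁
    R : Subset n
    R = X₂ ∪ (⁅ x ⁆ ∪ Y)
    R⁻ : ∀ {w} → w ∈ R → w ∈ X₂ ⊎ w ≡ x ⊎ w ∈ Y
    R⁻ w∈ = [ inj₁ , inj₂ ∘ [ inj₁ ∘ x∈⁅y⁆⇒x≡y x , inj₂ ]′ ∘ x∈p∪q⁻ ⁅ x ⁆ Y ]′ (x∈p∪q⁻ X₂ (⁅ x ⁆ ∪ Y) w∈)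
    X₂⊆R : X₂ ⊆ R
    X₂⊆R = p⊆p∪q _
    x∈R : x ∈ R
    x∈R = x∈p∪q⁺ (inj₂ (x∈p∪q⁺ (inj₁ (x∈⁅x⁆ x))))
    Y⊆R : Y ⊆ R
    Y⊆R w∈ = x∈p∪q⁺ (inj₂ (x∈p∪q⁺ (inj₂ w∈)))
    R⊆S : R ⊆ S
    R⊆S w∈ with R⁻ w∈
    ... | inj₁ w∈X₂ = J.left⊆ (I.right⊆ w∈X₂)
    ... | inj₂ (inj₁ refl) = J.joint∈
    ... | inj₂ (inj₂ w∈Y) = J.right⊆ w∈Y
    X≁v : ∀ {w} → w ∈ X → ¬ (w ~ v)
    X≁v w∈ e with Piece.boundary PX w∈ e
    ... | inj₁ v∈ = Piece.v∉ P (J.left⊆ v∈)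
    ... | inj₂ (inj₁ v≡u) = Piece.u≢v P (sym v≡u)
    ... | inj₂ (inj₂ v≡x) = Piece.u≢v PY (sym v≡x)
    X₁∩R : ∀ {w} → w ∈ X₁ → w ∈ R → ⊥
    X₁∩R w∈ w∈R with R⁻ w∈R
    ... | inj₁ w∈X₂ = I.disjoint w∈ w∈X₂
    ... | inj₂ (inj₁ refl) = J.joint∉left (I.left⊆ w∈)
    ... | inj₂ (inj₂ w∈Y) = J.disjoint (I.left⊆ w∈) w∈Y
    y∉R : y ∉ R
    y∉R y∈ with R⁻ y∈
    ... | inj₁ y∈X₂ = I.joint∉right y∈X₂
    ... | inj₂ (inj₁ refl) = J.joint∉left I.joint∈
    ... | inj₂ (inj₂ y∈Y) = J.disjoint I.joint∈ y∈Y
    boundaryR : ∀ {s w} → s ∈ R → s ~ w → w ∈ R ⊎ w ≡ y ⊎ w ≡ v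
    boundaryR s∈ e with R⁻ s∈
    boundaryR s∈ e | inj₁ s∈X₂ with Piece.boundary PX₂ s∈X₂ e
    ... | inj₁ w∈ = inj₁ (X₂⊆R w∈)
    ... | inj₂ (inj₁ w≡y) = inj₂ (inj₁ w≡y)
    ... | inj₂ (inj₂ refl) = inj₁ x∈R
    boundaryR s∈ e | inj₂ (inj₂ s∈Y) with Piece.boundary PY s∈Y e
    ... | inj₁ w∈ = inj₁ (Y⊆R w∈)
    ... | inj₂ (inj₁ refl) = inj₁ x∈R
    ... | inj₂ (inj₂ w≡v) = inj₂ (inj₂ w≡v)
    boundaryR s∈ e | inj₂ (inj₁ refl) with joint-neighbours P jt e
    ... | inj₂ (inj₂ (inj₁ w∈)) = inj₁ (Y⊆R w∈)
    ... | inj₂ (inj₂ (inj₂ w≡v)) = inj₂ (inj₂ w≡v)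
    ... | inj₁ refl = contradiction (x~u e) λ ()
    ... | inj₂ (inj₁ w∈X) with I.cover w∈X
    ... | inj₂ (inj₁ w≡y) = inj₂ (inj₁ w≡y)
    ... | inj₂ (inj₂ w∈X₂) = inj₁ (X₂⊆R w∈X₂)
    ... | inj₁ w∈X₁ with Piece.boundary PX₁ w∈X₁ (~-sym e)
    ... | inj₁ x∈X₁ = contradiction (I.left⊆ x∈X₁) J.joint∉left
    ... | inj₂ (inj₁ x≡u) = contradiction (sym x≡u) (Piece.u≢v PX)
    ... | inj₂ (inj₂ refl) = contradiction I.joint∈ J.joint∉left
    PR : Piece R y v
    PR = record
      { u∉ = y∉R ; v∉ = Piece.v∉ P ∘ R⊆S ; boundary = boundaryR
      ; u≢v = λ { refl → Piece.v∉ P (J.left⊆ I.joint∈) } }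
    jtR : Joint S X₁ y R
    jtR = record
      { cover = cover ; left⊆ = J.left⊆ ∘ I.left⊆ ; joint∈ = J.left⊆ I.joint∈ ; right⊆ = R⊆S
      ; disjoint = X₁∩R ; joint∉left = I.joint∉left ; joint∉right = y∉R }
      where
      cover : ∀ {s} → s ∈ S → s ∈ X₁ ⊎ s ≡ y ⊎ s ∈ R
      cover s∈ with J.cover s∈
      ... | inj₁ s∈X = [ inj₁ , inj₂ ∘ [ inj₁ , inj₂ ∘ X₂⊆R ]′ ]′ (I.cover s∈X)
      ... | inj₂ (inj₁ refl) = inj₂ (inj₂ x∈R)
      ... | inj₂ (inj₂ s∈Y) = inj₂ (inj₂ (Y⊆R s∈Y))
    jtR′ : Joint R X₂ x Y
    jtR′ = record
      { cover = R⁻ ; left⊆ = X₂⊆R ; joint∈ = x∈R ; right⊆ = Y⊆R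
      ; disjoint = λ w∈ → J.disjoint (I.right⊆ w∈)
      ; joint∉left = J.joint∉left ∘ I.right⊆ ; joint∉right = J.joint∉right }

  module _ (S : Subset n) (u v : Fin n) where
    private
      outer? : Decidable (λ w → w ∉ S × w ≢ u × w ≢ v)
      outer? w = ¬? (w ∈? S) ×-dec (¬? (w ≟ u) ×-dec ¬? (w ≟ v))

    Outer : Subset n
    Outer = comprehension outer?

    ∈Outer⁺ : ∀ {w} → w ∉ S → w ≢ u → w ≢ v → w ∈ Outer
    ∈Outer⁺ w∉ w≢u w≢v = ∈-comprehension⁺ outer? (w∉ , w≢u , w≢v)

    ∈Outer⁻ : ∀ {w} → w ∈ Outer → w ∉ S × w ≢ u × w ≢ v
    ∈Outer⁻ = ∈-comprehension⁻ outer?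

    Span : Pred (Fin n) _
    Span w = w ∈ S ⊎ w ≡ u ⊎ w ≡ v

  outer-piece : ∀ {S u v} → Piece S u v → Piece (Outer S u v) u v
  outer-piece {S} {u} {v} P = record
    { u∉ = λ u∈ → proj₁ (proj₂ (∈Outer⁻ S u v u∈)) refl
    ; v∉ = λ v∈ → proj₂ (proj₂ (∈Outer⁻ S u v v∈)) refl
    ; u≢v = u≢v ; boundary = boundary′ }
    where
    open Piece P
    boundary′ : ∀ {s w} → s ∈ Outer S u v → s ~ w → w ∈ Outer S u v ⊎ w ≡ u ⊎ w ≡ v
    boundary′ {s} {w} s∈ e with w ≟ u | w ≟ v | w ∈? S
    ... | yes w≡u | _ | _ = inj₂ (inj₁ w≡u)
    ... | no _ | yes w≡v | _ = inj₂ (inj₂ w≡v)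
    ... | no w≢u | no w≢v | no w∉ = inj₁ (∈Outer⁺ S u v w∉ w≢u w≢v)
    ... | no _ | no _ | yes w∈ with ∈Outer⁻ S u v s∈ | boundary w∈ (~-sym e)
    ... | s∉ , _ , _ | inj₁ s∈S = contradiction s∈S s∉
    ... | _ , s≢u , _ | inj₂ (inj₁ s≡u) = contradiction s≡u s≢u
    ... | _ , _ , s≢v | inj₂ (inj₂ s≡v) = contradiction s≡v s≢v

  -- In a 2-connected graph, this condition on a piece gives a u-v path through it or along the edge
  -- uv. Applied to `Outer S u v` it gives one avoiding S; the edge uv may serve for both.
  Linked : Subset n → Fin n → Fin n → Set
  Linked S u v = u ~ v ⊎ Nonempty S

  Two-connected : Set
  Two-connected = ∀ {x s t} → s ≢ x → t ≢ x → Walk (_≢ x) s t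

  module Decompose (ternary : Ternary01 G) (two-connected : Two-connected) where
    open Ternary ternary

    -- A walk from s to u that avoids v exists by 2-connectedness, and u is then its only way out of
    -- S.
    reach-u : ∀ {S u v s} → Piece S u v → s ∈ S → ∃[ a ] (a ∈ S × a ~ u × Walk (_∈ S) s a)
    reach-u {S} {u} {v} P s∈ = search s∈ (two-connected (λ { refl → v∉ s∈ }) u≢v)
      where
      open Piece P
      search : ∀ {s} → s ∈ S → Walk (_≢ v) s u → ∃[ a ] (a ∈ S × a ~ u × Walk (_∈ S) s a)
      search s∈ (stop _) = contradiction s∈ u∉
      search s∈ (go _ e p) with boundary s∈ e
      ... | inj₁ w∈ = let a , a∈ , a~u , q = search w∈ p in a , a∈ , a~u , go s∈ e q
      ... | inj₂ (inj₁ refl) = _ , s∈ , e , stop s∈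
      ... | inj₂ (inj₂ refl) = contradiction refl (walk-source p)

    reach-v : ∀ {S u v s} → Piece S u v → s ∈ S → ∃[ a ] (a ∈ S × a ~ v × Walk (_∈ S) s a)
    reach-v P = reach-u (swap-piece P)

    span-path : ∀ {S u v} → Piece S u v → Linked S u v → ∃[ q ] Path (Span S u v) u v q
    span-path P (inj₁ u~v) = 1 , go (inj₂ (inj₁ refl)) u~v (stop (inj₂ (inj₂ refl) , ≢-sym (Piece.u≢v P)))
    span-path P (inj₂ (s , s∈)) =
      let a , _ , a~u , p = reach-u P s∈
          b , b∈ , b~v , q = reach-v P s∈
      in walk⇒path (go (inj₂ (inj₁ refl)) (~-sym a~u)
           (walk-mono inj₁ (walk-reverse p ++ʷ q) ++ʷ go (inj₁ b∈) b~v (stop (inj₂ (inj₂ refl)))))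

    outer-path : ∀ {S u v} → Piece S u v → Linked (Outer S u v) u v → ∃[ o ] Path (_∉ S) u v o
    outer-path {S} {u} {v} P linked = let o , p = span-path (outer-piece P) linked in o , path-mono avoid p
      where
      avoid : Span (Outer S u v) u v ⋐ (_∉ S)
      avoid (inj₁ w∈) = proj₁ (∈Outer⁻ S u v w∈)
      avoid (inj₂ (inj₁ refl)) = Piece.u∉ P
      avoid (inj₂ (inj₂ refl)) = Piece.v∉ P

    -- `Far` is connected because every outer vertex reaches v without u, and `out-linked` makes it
    -- touch u. The halves X and Y touch each other since they cover the connected set S.
    no-linkage : ∀ {S u v} → Piece S u v → Linked (Outer S u v) u v → Connected-set S →
                 ¬ Linkage S (u ~_) (v ~_)
    no-linkage {S} {u} {v} P out-linked S-conn L = no-K₄-minor (record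
      { B₀ = _≡ u ; B₁ = Far ; B₂ = _∈ X ; B₃ = _∈ Y
      ; conn₀ = λ { refl refl → stop refl }
      ; conn₁ = rooted⇒connected v (walk-reverse ∘ far-walk)
      ; conn₂ = X-connected ; conn₃ = Y-connected
      ; disj₀₁ = λ { refl → [ (λ u∈ → proj₁ (proj₂ (∈Outer⁻ S u v u∈)) refl) , u≢v ]′ }
      ; disj₀₂ = λ { refl → u∉ ∘ X⊆ } ; disj₀₃ = λ { refl → u∉ ∘ Y⊆ }
      ; disj₁₂ = λ f → far∉ f ∘ X⊆ ; disj₁₃ = λ f → far∉ f ∘ Y⊆ ; disj₂₃ = disjoint
      ; edge₀₁ = u-far out-linked
      ; edge₀₂ = let a , a∈ , u~a = X-A in u , a , refl , a∈ , u~a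
      ; edge₀₃ = let a , a∈ , u~a = Y-A in u , a , refl , a∈ , u~a
      ; edge₁₂ = let b , b∈ , v~b = X-B in v , b , inj₂ refl , b∈ , v~b
      ; edge₁₃ = let b , b∈ , v~b = Y-B in v , b , inj₂ refl , b∈ , v~b
      ; edge₂₃ = let a , a∈ , _ = X-A ; b , b∈ , _ = Y-A in crossing a∈ b∈ (S-conn (X⊆ a∈) (Y⊆ b∈)) })
      where
      open Piece P
      open Linkage L
      Far : Pred (Fin n) _
      Far w = w ∈ Outer S u v ⊎ w ≡ v
      far∉ : ∀ {w} → Far w → w ∉ S
      far∉ (inj₁ w∈) = proj₁ (∈Outer⁻ S u v w∈)
      far∉ (inj₂ refl) = v∉
      far-walk : ∀ {w} → Far w → Walk Far w v
      far-walk (inj₂ refl) = stop (inj₂ refl)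
      far-walk (inj₁ w∈) = let b , b∈ , b~v , p = reach-v (outer-piece P) w∈ in
        walk-mono inj₁ p ++ʷ go (inj₁ b∈) b~v (stop (inj₂ refl))
      u-far : Linked (Outer S u v) u v → Touching (_≡ u) Far
      u-far (inj₁ u~v) = u , v , refl , inj₂ refl , u~v
      u-far (inj₂ (e , e∈)) = let a , a∈ , a~u , _ = reach-u (outer-piece P) e∈ in u , a , refl , inj₁ a∈ , ~-sym a~u
      crossing : ∀ {a b} → a ∈ X → b ∈ Y → Walk (_∈ S) a b → Touching (_∈ X) (_∈ Y)
      crossing a∈ b∈ (stop _) = ⊥-elim (disjoint a∈ b∈)
      crossing a∈ b∈ (go _ e p) =
        [ (λ w∈ → crossing w∈ b∈ p) , (λ w∈ → _ , _ , a∈ , w∈ , e) ]′ (cover (walk-source p))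

    -- `outer-length` fixes the residue of k + 1 by comparison with paths outside S, the form in
    -- which two pieces can be compared. `simple` is the invariant that `link` asks for: adjacent
    -- terminals force a single network.
    record Decomposed (S : Subset n) (u v : Fin n) : Set where
      field
        k m : ℕ
        chain : Chain u v S k m
        simple : u ~ v → k ≡ 0
        outer-length : ∀ {o} → Path (_∉ S) u v o → Two (suc k + o)

    as-net : ∀ {S u v k m} j → k ≡ j * 3 → Chain u v S k m →
             (∀ {o} → Path (_∉ S) u v o → Two (suc k + o)) → Decomposed S u v
    as-net {m = m} j refl C outer-length = record
      { k = 0 ; m = j + m ; chain = [ ser j refl C ] ; simple = λ _ → refl
      ; outer-length = λ {o} p → Two-reduce j o (outer-length p) }

    module Parallel {S u v} (P : Piece S u v) (out-linked : Linked (Outer S u v) u v)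
                    {C R : Subset n} (sp : Splits S C R) (C-closed : Closed-in S C)
                    (C≠∅ : Nonempty C) (R≠∅ : Nonempty R) where
      open Piece P
      open Splits sp

      C-piece : Piece C u v
      C-piece = record
        { u∉ = u∉ ∘ left⊆ ; v∉ = v∉ ∘ left⊆ ; u≢v = u≢v
        ; boundary = λ s∈ e → [ (λ w∈ → inj₁ (C-closed s∈ w∈ e)) , inj₂ ]′ (boundary (left⊆ s∈) e) }

      R-piece : Piece R u v
      R-piece = record { u∉ = u∉ ∘ right⊆ ; v∉ = v∉ ∘ right⊆ ; u≢v = u≢v ; boundary = boundary′ }
        where
        boundary′ : ∀ {s w} → s ∈ R → s ~ w → w ∈ R ⊎ w ≡ u ⊎ w ≡ v
        boundary′ s∈ e with boundary (right⊆ s∈) e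
        ... | inj₂ end = inj₂ end
        ... | inj₁ w∈ with cover w∈
        ... | inj₂ w∈R = inj₁ w∈R
        ... | inj₁ w∈C = ⊥-elim (disjoint (C-closed w∈C (right⊆ s∈) (~-sym e)) s∈)

      C-outside : Linked (Outer C u v) u v
      C-outside = let r , r∈ = R≠∅ in inj₂ (r , ∈Outer⁺ C u v (λ r∈C → disjoint r∈C r∈)
        (λ { refl → u∉ (right⊆ r∈) }) (λ { refl → v∉ (right⊆ r∈) }))

      R-outside : Linked (Outer R u v) u v
      R-outside = let c , c∈ = C≠∅ in inj₂ (c , ∈Outer⁺ R u v (disjoint c∈)
        (λ { refl → u∉ (left⊆ c∈) }) (λ { refl → v∉ (left⊆ c∈) }))

      assemble : Decomposed C u v → Decomposed R u v → Decomposed S u v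
      assemble DC DR = record
        { k = 0 ; m = _ ; simple = λ _ → refl
        ; chain = [ par C-piece R-piece sp (ser (proj₁ C-mult) (proj₂ C-mult) C.chain)
                                           (ser (proj₁ R-mult) (proj₂ R-mult) R.chain) ]
        ; outer-length = λ {o} p → Two-reduce (proj₁ C-mult) o
            (subst (λ k → Two (suc k + o)) (proj₂ C-mult) (C.outer-length (path-mono (λ w∉ → w∉ ∘ left⊆) p))) }
        where
        module C = Decomposed DC
        module R = Decomposed DR
        span∉ : ∀ {X Z} → X ⊆ S → (∀ {w} → w ∈ X → w ∉ Z) → Z ⊆ S → Span X u v ⋐ (_∉ Z)
        span∉ X⊆ disj Z⊆ (inj₁ w∈) = disj w∈
        span∉ X⊆ disj Z⊆ (inj₂ (inj₁ refl)) = u∉ ∘ Z⊆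
        span∉ X⊆ disj Z⊆ (inj₂ (inj₂ refl)) = v∉ ∘ Z⊆
        o = proj₁ (outer-path P out-linked)
        outer = proj₂ (outer-path P out-linked)
        qC = proj₁ (span-path C-piece (inj₂ C≠∅))
        C-path = proj₂ (span-path C-piece (inj₂ C≠∅))
        qR = proj₁ (span-path R-piece (inj₂ R≠∅))
        R-path = proj₂ (span-path R-piece (inj₂ R≠∅))
        meet : ∀ {w} → Span C u v w → Span R u v w → w ≡ u ⊎ w ≡ v
        meet (inj₂ end) _ = end
        meet (inj₁ _) (inj₂ end) = end
        meet (inj₁ w∈C) (inj₁ w∈R) = ⊥-elim (disjoint w∈C w∈R)
        C+o : Two (suc C.k + o)
        C+o = C.outer-length (path-mono (λ w∉ → w∉ ∘ left⊆) outer)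
        R+o : Two (suc R.k + o)
        R+o = R.outer-length (path-mono (λ w∉ → w∉ ∘ right⊆) outer)
        -- The actual paths through C and R form a cycle; as each lies outside the other piece,
        -- their lengths may be traded for the numbers of networks. With the outer path this makes
        -- three pairwise sums of residue 2, so both chains have length 1 mod 3.
        C+R : Two (suc C.k + suc R.k)
        C+R = Two-+ qC (two-paths u≢v C-path (path-reverse R-path) meet)
          {suc C.k} (C.outer-length (path-mono (span∉ right⊆ (λ r∈ c∈ → disjoint c∈ r∈) left⊆) R-path))
          {suc R.k} (subst Two (+-comm (suc R.k) qC) (R.outer-length (path-mono (span∉ left⊆ disjoint right⊆) C-path)))
        C-mult : ∃[ j ] (C.k ≡ j * 3)
        C-mult = Two-double C.k (Two-+ (suc R.k) R+o {suc C.k} C+o (subst Two (+-comm (suc C.k) (suc R.k)) C+R))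
        R-mult : ∃[ j ] (R.k ≡ j * 3)
        R-mult = Two-double R.k (Two-+ (suc C.k) C+o {suc R.k} R+o C+R)

    -- X is all that can be reached from the neighbours of u in S without x, and Y is what remains.
    -- So Y has no edge to u by construction, and X none to v because x separates.
    module Series {S u v} (P : Piece S u v) (S≠∅ : Nonempty S) {x} (x∈ : x ∈ S)
                  (sep : Separates S (u ~_) (v ~_) x) where
      open Piece P

      rest? : Decidable (λ w → w ∈ S × w ≢ x)
      rest? w = w ∈? S ×-dec ¬? (w ≟ x)
      rest : Subset n
      rest = comprehension rest?
      near? : Decidable (λ w → w ∈ rest × u ~ w)
      near? w = w ∈? rest ×-dec T? (adj G u w)
      open Closure (closure rest (comprehension near?) (proj₁ ∘ ∈-comprehension⁻ near?))
        renaming (hull to X; hull⊆ to X⊆rest)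
      right? : Decidable (λ w → w ∈ rest × w ∉ X)
      right? w = w ∈? rest ×-dec ¬? (w ∈? X)
      Y : Subset n
      Y = comprehension right?

      rest⁻ : ∀ {w} → w ∈ rest → w ∈ S × w ≢ x
      rest⁻ = ∈-comprehension⁻ rest?
      rest⁺ : ∀ {w} → w ∈ S → w ≢ x → w ∈ rest
      rest⁺ w∈ w≢ = ∈-comprehension⁺ rest? (w∈ , w≢)
      X⊆S : X ⊆ S
      X⊆S = proj₁ ∘ rest⁻ ∘ X⊆rest
      Y⁻ : ∀ {w} → w ∈ Y → w ∈ rest × w ∉ X
      Y⁻ = ∈-comprehension⁻ right?
      Y⁺ : ∀ {w} → w ∈ rest → w ∉ X → w ∈ Y
      Y⁺ w∈ w∉ = ∈-comprehension⁺ right? (w∈ , w∉)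
      Y⊆S : Y ⊆ S
      Y⊆S = proj₁ ∘ rest⁻ ∘ proj₁ ∘ Y⁻
      x∉X : x ∉ X
      x∉X x∈X = proj₂ (rest⁻ (X⊆rest x∈X)) refl
      x∉Y : x ∉ Y
      x∉Y x∈Y = proj₂ (rest⁻ (proj₁ (Y⁻ x∈Y))) refl
      u≢x : u ≢ x
      u≢x refl = u∉ x∈
      x≢v : x ≢ v
      x≢v refl = v∉ x∈

      u-near : ∀ {w} → w ∈ rest → w ~ u → w ∈ X
      u-near w∈ e = seed⊆ (∈-comprehension⁺ near? (w∈ , ~-sym e))

      X≁v : ∀ {w} → w ∈ X → ¬ (w ~ v)
      X≁v w∈ w~v = let r , r∈ , p = rooted w∈ in
        sep (proj₂ (∈-comprehension⁻ near? r∈)) (~-sym w~v) (walk-mono (rest⁻ ∘ X⊆rest) p)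

      joint : Joint S X x Y
      joint = record
        { cover = cover ; left⊆ = X⊆S ; joint∈ = x∈ ; right⊆ = Y⊆S ; disjoint = λ w∈X w∈Y → proj₂ (Y⁻ w∈Y) w∈X
        ; joint∉left = x∉X ; joint∉right = x∉Y }
        where
        cover : ∀ {s} → s ∈ S → s ∈ X ⊎ s ≡ x ⊎ s ∈ Y
        cover {s} s∈ with s ≟ x | s ∈? X
        ... | yes s≡x | _ = inj₂ (inj₁ s≡x)
        ... | no _ | yes s∈X = inj₁ s∈X
        ... | no s≢x | no s∉X = inj₂ (inj₂ (Y⁺ (rest⁺ s∈ s≢x) s∉X))

      X-piece : Piece X u x
      X-piece = record { u∉ = u∉ ∘ X⊆S ; v∉ = x∉X ; u≢v = u≢x ; boundary = boundary′ }
        where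
        boundary′ : ∀ {s w} → s ∈ X → s ~ w → w ∈ X ⊎ w ≡ u ⊎ w ≡ x
        boundary′ {w = w} s∈ e with boundary (X⊆S s∈) e
        ... | inj₂ (inj₁ w≡u) = inj₂ (inj₁ w≡u)
        ... | inj₂ (inj₂ refl) = contradiction e (X≁v s∈)
        ... | inj₁ w∈ with w ≟ x
        ... | yes w≡x = inj₂ (inj₂ w≡x)
        ... | no w≢x = inj₁ (closed s∈ (rest⁺ w∈ w≢x) e)

      Y-piece : Piece Y x v
      Y-piece = record { u∉ = x∉Y ; v∉ = v∉ ∘ Y⊆S ; u≢v = x≢v ; boundary = boundary′ }
        where
        boundary′ : ∀ {s w} → s ∈ Y → s ~ w → w ∈ Y ⊎ w ≡ x ⊎ w ≡ v
        boundary′ {w = w} s∈ e with boundary (Y⊆S s∈) e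
        ... | inj₂ (inj₁ refl) = contradiction (u-near (proj₁ (Y⁻ s∈)) e) (proj₂ (Y⁻ s∈))
        ... | inj₂ (inj₂ w≡v) = inj₂ (inj₂ w≡v)
        ... | inj₁ w∈ with w ≟ x | w ∈? X
        ... | yes w≡x | _ = inj₂ (inj₁ w≡x)
        ... | no w≢x | no w∉X = inj₁ (Y⁺ (rest⁺ w∈ w≢x) w∉X)
        ... | no _ | yes w∈X = contradiction (closed w∈X (proj₁ (Y⁻ s∈)) (~-sym e)) (proj₂ (Y⁻ s∈))

      X-outside : Linked (Outer X u x) u x
      X-outside = inj₂ (v , ∈Outer⁺ X u x (v∉ ∘ X⊆S) (≢-sym u≢v) (≢-sym x≢v))

      Y-outside : Linked (Outer Y x v) x v
      Y-outside = inj₂ (u , ∈Outer⁺ Y x v (u∉ ∘ Y⊆S) u≢x u≢v)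

      X-inside : Linked X u x
      X-inside with reach-u P (proj₂ S≠∅)
      ... | a , a∈ , a~u , _ with a ≟ x
      ... | yes refl = inj₁ (~-sym a~u)
      ... | no a≢x = inj₂ (a , u-near (rest⁺ a∈ a≢x) a~u)

      Y-inside : Linked Y x v
      Y-inside with reach-v P (proj₂ S≠∅)
      ... | b , b∈ , b~v , _ with b ≟ x
      ... | yes refl = inj₁ b~v
      ... | no b≢x = inj₂ (b , Y⁺ (rest⁺ b∈ b≢x) (λ b∈X → X≁v b∈X b~v))

      X⊂S : X ⊂ S
      X⊂S = X⊆S , x , x∈ , x∉X

      Y⊂S : Y ⊂ S
      Y⊂S = Y⊆S , x , x∈ , x∉Y

      module Glue (DX : Decomposed X u x) (DY : Decomposed Y x v) where
        private
          module X = Decomposed DX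
          module Y = Decomposed DY
          q = proj₁ (span-path X-piece X-inside)
          X-path = proj₂ (span-path X-piece X-inside)
          r = proj₁ (span-path Y-piece Y-inside)
          Y-path = proj₂ (span-path Y-piece Y-inside)

        C : Chain u v S (X.k + suc Y.k) (X.m + Y.m)
        C = chain-append P X-piece Y-piece joint (X.simple ∘ ~-sym) Y.simple X.chain Y.chain

        outer-length : ∀ {o} → Path (_∉ S) u v o → Two (suc (X.k + suc Y.k) + o)
        -- p followed by the way back through Y lies outside X, and p preceded by the way through X
        -- lies outside Y. The sum of these two relations contains the cycle of length q + r + o
        -- once in excess.
        outer-length {o} p = combine (suc X.k + (o + r)) (suc Y.k + (q + o)) (q + r + o)
          (identity (pos X.k) (pos Y.k) (pos o) (pos q) (pos r))
          (X.outer-length (path-mono avoid-X (path-concat p (path-reverse Y-path) meet-v)))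
          (Y.outer-length (path-mono avoid-Y (path-concat (path-reverse X-path) p meet-u)))
          (two-paths u≢v (path-concat X-path Y-path meet-x) (path-reverse p) meet-uv)
          where
          identity : ∀ k l o q r →
            ((pos 1 ℤ.+ k) ℤ.+ (o ℤ.+ r) ℤ.+ ((pos 1 ℤ.+ l) ℤ.+ (q ℤ.+ o))) ℤ.- (q ℤ.+ r ℤ.+ o) ≡
            (pos 1 ℤ.+ (k ℤ.+ (pos 1 ℤ.+ l))) ℤ.+ o
          identity = ℤ-Solver.solve-∀
          meet-v : ∀ {w} → w ∉ S → Span Y x v w → w ≡ v
          meet-v w∉ (inj₁ w∈Y) = contradiction (Y⊆S w∈Y) w∉
          meet-v w∉ (inj₂ (inj₁ refl)) = contradiction x∈ w∉
          meet-v w∉ (inj₂ (inj₂ w≡v)) = w≡v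
          meet-u : ∀ {w} → Span X u x w → w ∉ S → w ≡ u
          meet-u (inj₁ w∈X) w∉ = contradiction (X⊆S w∈X) w∉
          meet-u (inj₂ (inj₁ w≡u)) w∉ = w≡u
          meet-u (inj₂ (inj₂ refl)) w∉ = contradiction x∈ w∉
          meet-x : ∀ {w} → Span X u x w → Span Y x v w → w ≡ x
          meet-x (inj₂ (inj₂ w≡x)) _ = w≡x
          meet-x _ (inj₂ (inj₁ w≡x)) = w≡x
          meet-x (inj₁ w∈X) (inj₁ w∈Y) = contradiction w∈X (proj₂ (Y⁻ w∈Y))
          meet-x (inj₁ v∈X) (inj₂ (inj₂ refl)) = contradiction (X⊆S v∈X) v∉
          meet-x (inj₂ (inj₁ refl)) (inj₁ u∈Y) = contradiction (Y⊆S u∈Y) u∉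
          meet-x (inj₂ (inj₁ refl)) (inj₂ (inj₂ u≡v)) = contradiction u≡v u≢v
          meet-uv : ∀ {w} → (Span X u x ⋓ Span Y x v) w → w ∉ S → w ≡ u ⊎ w ≡ v
          meet-uv (inj₁ w∈) w∉ = inj₁ (meet-u w∈ w∉)
          meet-uv (inj₂ w∈) w∉ = inj₂ (meet-v w∉ w∈)
          avoid-X : ((_∉ S) ⋓ Span Y x v) ⋐ (_∉ X)
          avoid-X (inj₁ w∉) = w∉ ∘ X⊆S
          avoid-X (inj₂ (inj₁ w∈Y)) = proj₂ (Y⁻ w∈Y)
          avoid-X (inj₂ (inj₂ (inj₁ refl))) = x∉X
          avoid-X (inj₂ (inj₂ (inj₂ refl))) = v∉ ∘ X⊆S
          avoid-Y : (Span X u x ⋓ (_∉ S)) ⋐ (_∉ Y)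
          avoid-Y (inj₁ (inj₁ w∈X)) w∈Y = proj₂ (Y⁻ w∈Y) w∈X
          avoid-Y (inj₁ (inj₂ (inj₁ refl))) = u∉ ∘ Y⊆S
          avoid-Y (inj₁ (inj₂ (inj₂ refl))) = x∉Y
          avoid-Y (inj₂ w∉) = w∉ ∘ Y⊆S

      assemble : Decomposed X u x → Decomposed Y x v → Decomposed S u v
      assemble DX DY with T? (adj G u v)
      ... | no u≁v = record
        { k = _ ; m = _ ; chain = C ; simple = λ e → contradiction e u≁v ; outer-length = outer-length }
        where open Glue DX DY
      -- The edge uv is itself an outer path of length 1. It forces 3 to divide the number of
      -- joints, so the chain can be wrapped into one network and `simple` is preserved.
      ... | yes u~v = let j , eq = Two-suc+1 _ (outer-length edge-path) in as-net j eq C outer-length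
        where
        open Glue DX DY
        edge-path : Path (_∉ S) u v 1
        edge-path = go u∉ u~v (stop (v∉ , ≢-sym u≢v))

    decompose : ∀ {S u v} → Piece S u v → Linked S u v → Linked (Outer S u v) u v → Decomposed S u v
    decompose {S} = search (⊂-wellFounded S)
      where
      search : ∀ {S u v} → Acc _⊂_ S → Piece S u v → Linked S u v → Linked (Outer S u v) u v → Decomposed S u v
      search {S} {u} {v} (acc rec) P in-linked out-linked with nonempty? S
      ... | no empty = trivial in-linked
        where
        trivial : Linked S u v → Decomposed S u v
        trivial (inj₂ nonempty) = contradiction nonempty empty
        trivial (inj₁ u~v) = record
          { k = 0 ; m = 0 ; chain = [ edge u~v empty ] ; simple = λ _ → refl
          ; outer-length = λ p → two-paths (Piece.u≢v P)
              (go {W = λ w → w ≡ u ⊎ w ≡ v} (inj₁ refl) u~v (stop (inj₂ refl , ≢-sym (Piece.u≢v P))))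
              (path-reverse p) (λ end _ → end) }
      ... | yes (s , s∈) = split (nonempty? R)
        where
        open Component (component S s∈) renaming (part to C; part⊆ to C⊆S)
        remaining? : Decidable (λ w → w ∈ S × w ∉ C)
        remaining? w = w ∈? S ×-dec ¬? (w ∈? C)
        R : Subset n
        R = comprehension remaining?
        R⁻ : ∀ {w} → w ∈ R → w ∈ S × w ∉ C
        R⁻ = ∈-comprehension⁻ remaining?
        sp : Splits S C R
        sp = record { cover = cover ; left⊆ = C⊆S ; right⊆ = proj₁ ∘ R⁻ ; disjoint = λ w∈C w∈R → proj₂ (R⁻ w∈R) w∈C }
          where
          cover : ∀ {w} → w ∈ S → w ∈ C ⊎ w ∈ R
          cover {w} w∈ with w ∈? C
          ... | yes w∈C = inj₁ w∈C
          ... | no w∉C = inj₂ (∈-comprehension⁺ remaining? (w∈ , w∉C))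
        split : Dec (Nonempty R) → Decomposed S u v
        split (yes (r , r∈)) = Par.assemble
          (search (rec (C⊆S , r , R⁻ r∈)) Par.C-piece (inj₂ (s , member)) Par.C-outside)
          (search (rec (proj₁ ∘ R⁻ , s , s∈ , λ s∈R → proj₂ (R⁻ s∈R) member)) Par.R-piece (inj₂ (r , r∈)) Par.R-outside)
          where module Par = Parallel P out-linked sp closed (s , member) (r , r∈)
        split (no R-empty) = cut (separator-or-linkage S (λ w → T? (adj G u w)) (λ w → T? (adj G v w)) S-conn
            (let a , a∈ , a~u , _ = reach-u P s∈ in a , a∈ , ~-sym a~u))
          where
          S⊆C : S ⊆ C
          S⊆C w∈ = [ id , (λ w∈R → contradiction (_ , w∈R) R-empty) ]′ (Splits.cover sp w∈)
          S-conn : Connected-set S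
          S-conn x∈ y∈ = walk-mono C⊆S (connected (S⊆C x∈) (S⊆C y∈))
          cut : (∃[ x ] (x ∈ S × Separates S (u ~_) (v ~_) x)) ⊎ Linkage S (u ~_) (v ~_) → Decomposed S u v
          cut (inj₂ L) = contradiction L (no-linkage P out-linked S-conn)
          cut (inj₁ (x , x∈ , sep)) = Ser.assemble
            (search (rec Ser.X⊂S) Ser.X-piece Ser.X-inside Ser.X-outside)
            (search (rec Ser.Y⊂S) Ser.Y-piece Ser.Y-inside Ser.Y-outside)
            where module Ser = Series P (s , s∈) x∈ sep

-- Deletion of a vertex in terms of walks and dominating sets.

two-connected-walks : ∀ {n} (G : SimpleGraph n) → TwoConnected G → Decomposition.Two-connected G
two-connected-walks G (inj₁ (refl , _)) {x} {s} {t} s≢x t≢x =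
  subst (Paths.Walk G (_≢ x) s) (equal x s t s≢x t≢x) (Paths.stop s≢x)
  where
  equal : ∀ (x s t : Fin 2) → s ≢ x → t ≢ x → s ≡ t
  equal _ zero zero _ _ = refl
  equal _ (suc zero) (suc zero) _ _ = refl
  equal zero zero _ s≢x _ = contradiction refl s≢x
  equal zero _ zero _ t≢x = contradiction refl t≢x
  equal (suc zero) (suc zero) _ s≢x _ = contradiction refl s≢x
  equal (suc zero) _ (suc zero) _ t≢x = contradiction refl t≢x
two-connected-walks {suc n} G (inj₂ (_ , _ , connected)) {x} {s} {t} s≢x t≢x =
  subst₂ (Walk (_≢ x)) (punchIn-punchOut (≢-sym s≢x)) (punchIn-punchOut (≢-sym t≢x))
    (lift (connected x (punchOut (≢-sym s≢x)) (punchOut (≢-sym t≢x))))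
  where
  open Paths G
  lift : ∀ {a b} → Reachable (G ─ x) a b → Walk (_≢ x) (punchIn x a) (punchIn x b)
  lift here = stop (punchInᵢ≢i x _)
  lift (step e p) = go (punchInᵢ≢i x _) e (lift p)

neighbour : ∀ {n} (G : SimpleGraph n) → TwoConnected G → ∀ x → ∃[ y ] Adj G x y
neighbour G (inj₁ (refl , complete)) zero = suc zero , complete zero (suc zero) λ ()
neighbour G (inj₁ (refl , complete)) (suc zero) = zero , complete (suc zero) zero λ ()
neighbour {suc (suc n)} G (inj₂ (_ , connected , _)) x = first (≢-sym (punchInᵢ≢i x zero)) (connected x (punchIn x zero))
  where
  first : ∀ {y} → x ≢ y → Reachable G x y → ∃[ z ] Adj G x z
  first x≢x here = contradiction refl x≢x
  first _ (step e _) = _ , e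
neighbour {suc zero} G (inj₂ (s≤s () , _)) x

restore-vertex : ∀ {n} (G : SimpleGraph n) x (B : Subset (pred n)) → Dominating (G ─ x) B →
  ∃[ A ] (∣ A ∣ ≡ ∣ B ∣ × (∀ {w} → w ≢ x → w ∈ A ⊎ ∃[ y ] (y ∈ A × Adj G y w)))
restore-vertex {suc n} G x B dominating = A , ∣insert∣ B x , dominates
  where
  A : Subset (suc n)
  A = insertAt B x outside
  ∣insert∣ : ∀ {n} (B : Subset n) x → ∣ insertAt B x outside ∣ ≡ ∣ B ∣
  ∣insert∣ B zero = refl
  ∣insert∣ (inside ∷ B) (suc x) = cong suc (∣insert∣ B x)
  ∣insert∣ (outside ∷ B) (suc x) = ∣insert∣ B x
  ∈A : ∀ {i} → i ∈ B → punchIn x i ∈ A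
  ∈A {i} i∈ = lookup⇒[]= (punchIn x i) A (trans (insertAt-punchIn B x outside i) ([]=⇒lookup i∈))
  dominates : ∀ {w} → w ≢ x → w ∈ A ⊎ ∃[ y ] (y ∈ A × Adj G y w)
  dominates {w} w≢x = subst (λ w → w ∈ A ⊎ ∃[ y ] (y ∈ A × Adj G y w)) (punchIn-punchOut (≢-sym w≢x))
    ([ inj₁ ∘ ∈A , (λ (y , y∈ , e) → inj₂ (punchIn x y , ∈A y∈ , e)) ]′ (dominating (punchOut (≢-sym w≢x))))

-- An edge as a pair of terminals.

module Extremal {n : ℕ} (G : SimpleGraph n) where
  open Decomposition G public

  Rest : Fin n → Fin n → Subset n
  Rest = Outer ∅

  ∈Rest⁺ : ∀ {u v w} → w ≢ u → w ≢ v → w ∈ Rest u v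
  ∈Rest⁺ = ∈Outer⁺ ∅ _ _ ∉⊥

  ∈Rest⁻ : ∀ {u v w} → w ∈ Rest u v → w ≢ u × w ≢ v
  ∈Rest⁻ = proj₂ ∘ ∈Outer⁻ ∅ _ _

  locate : ∀ u v w → w ∈ Rest u v ⊎ w ≡ u ⊎ w ≡ v
  locate u v w with w ≟ u | w ≟ v
  ... | yes w≡u | _ = inj₂ (inj₁ w≡u)
  ... | no _ | yes w≡v = inj₂ (inj₂ w≡v)
  ... | no w≢u | no w≢v = inj₁ (∈Rest⁺ w≢u w≢v)

  rest-joint : ∀ {u v} → u ≢ v → Joint full ⁅ u ⁆ v (Rest u v)
  rest-joint {u} {v} u≢v = record
    { cover = λ {w} _ → [ inj₂ ∘ inj₂ , [ (λ { refl → inj₁ (x∈⁅x⁆ u) }) , inj₂ ∘ inj₁ ]′ ]′ (locate u v w)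
    ; left⊆ = λ _ → ∈⊤ ; joint∈ = ∈⊤ ; right⊆ = λ _ → ∈⊤
    ; disjoint = λ w∈u w∈ → proj₁ (∈Rest⁻ w∈) (x∈⁅y⁆⇒x≡y u w∈u)
    ; joint∉left = λ v∈u → u≢v (sym (x∈⁅y⁆⇒x≡y u v∈u))
    ; joint∉right = λ v∈ → proj₂ (∈Rest⁻ v∈) refl }

  rest-piece : ∀ {u v} → u ≢ v → Piece (Rest u v) u v
  rest-piece {u} {v} u≢v = record
    { u∉ = λ u∈ → proj₁ (∈Rest⁻ u∈) refl ; v∉ = λ v∈ → proj₂ (∈Rest⁻ v∈) refl
    ; u≢v = u≢v ; boundary = λ {_} {w} _ _ → locate u v w }

  ∣∣-by-rest : ∀ {u v} → u ≢ v → ∀ A → ∣ A ∣ ≡ indicator A u + (indicator A v + ∣ A ∩ Rest u v ∣)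
  ∣∣-by-rest u≢v A = trans (cong ∣_∣ (sym (∩-identityʳ A))) (joint-∣∩∣ (rest-joint u≢v) A)

  ∣Rest∣ : ∀ {u v m} → u ≢ v → n ≡ 3 * m + 2 → ∣ Rest u v ∣ ≡ 3 * m
  ∣Rest∣ {u} {v} {m} u≢v n≡ = +-cancelˡ-≡ 2 ∣ Rest u v ∣ (3 * m) (begin
    2 + ∣ Rest u v ∣               ≡⟨ cong (_+ suc ∣ Rest u v ∣) (∣⁅x⁆∣≡1 u) ⟨
    ∣ ⁅ u ⁆ ∣ + suc ∣ Rest u v ∣   ≡⟨ joint-∣∣ (rest-joint u≢v) ⟨
    ∣ full {n} ∣                   ≡⟨ ∣⊤∣≡n n ⟩
    n                              ≡⟨ n≡ ⟩
    3 * m + 2                      ≡⟨ +-comm (3 * m) 2 ⟩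
    2 + 3 * m                      ∎)
    where open ≡-Reasoning

  joint-free : ∀ {u v S k m} → k ≡ 0 → Chain u v S k m → Net u v S m
  joint-free refl [ N ] = N

  -- The edge uv links its ends inside and outside at once, and through `simple` it leaves no joint.
  -- The index of the network is then determined by the number of vertices.
  edge-net : ∀ {u v m} → Ternary01 G → TwoConnected G → n ≡ 3 * m + 2 → u ~ v → Net u v (Rest u v) m
  edge-net {u} {v} {m} ternary 2-conn n≡ u~v =
    subst (Net u v (Rest u v)) (*-cancelˡ-≡ D.m m 3 (trans (sym (net-size N)) (∣Rest∣ {m = m} u≢v n≡))) N
    where
    u≢v = ~-irrefl u~v
    module D = Decompose.Decomposed (Decompose.decompose ternary (two-connected-walks G 2-conn)
      (rest-piece u≢v) (inj₁ u~v) (inj₁ u~v))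
    N = joint-free (D.simple u~v) D.chain

  -- A need not dominate u; this covers the independent dominating sets of G as well as those of G - u.
  lower-bound : ∀ {u v m} → u ~ v → Net u v (Rest u v) m → ∀ A →
    (∀ {w} → w ≢ u → w ∈ A ⊎ ∃[ y ] (y ∈ A × y ~ w)) → suc m ≤ ∣ A ∣
  lower-bound {u} {v} {m} u~v N A dom = subst (suc m ≤_) (sym (∣∣-by-rest u≢v A)) (cases (u ∈? A) (v ∈? A))
    where
    u≢v = ~-irrefl u~v
    a = ∣ A ∩ Rest u v ∣
    dom-rest : Dominates A (Rest u v)
    dom-rest w∈ = dom (proj₁ (∈Rest⁻ w∈))
    cases : Dec (u ∈ A) → Dec (v ∈ A) → suc m ≤ indicator A u + (indicator A v + a)
    cases (yes u∈) _ = +-mono-≤ (≤-reflexive (sym (indicator-∈ u∈))) (≤-trans (net-≤ N A dom-rest) (m≤n+m a _))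
    cases (no _) (yes v∈) =
      ≤-trans (+-mono-≤ (≤-reflexive (sym (indicator-∈ v∈))) (net-≤ N A dom-rest)) (m≤n+m _ (indicator A u))
    cases (no u∉) (no v∉) with dom (≢-sym u≢v)
    ... | inj₁ v∈ = contradiction v∈ v∉
    -- v has credit and both indicators vanish, so 3m + 1 ≤ 3a; rounding turns this into m + 1 ≤ a.
    ... | inj₂ (w , w∈ , w~v) = ≤-trans (3≤3+2⇒≤ {suc m} {a} 3+3m≤3a+2) (≤-trans (m≤n+m a _) (m≤n+m _ (indicator A u)))
      where
      w∈Rest : w ∈ Rest u v
      w∈Rest = ∈Rest⁺ (λ { refl → u∉ w∈ }) (λ { refl → v∉ w∈ })
      regroup : ∀ m → 3 * m + (0 + 1) + 2 ≡ 3 * suc m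
      regroup = ℕ-Solver.solve-∀
      3+3m≤3a+2 : 3 * suc m ≤ 3 * a + 2
      3+3m≤3a+2 = subst₂ _≤_ (regroup m)
        (cong (_+ 2) (trans (cong (λ z → 3 * a + z) (cong₂ _+_ (indicator-∉ u∉) (indicator-∉ v∉))) (+-identityʳ (3 * a))))
        (+-mono-≤ (net-bound N A dom-rest none (gain v∉ w∈ w~v w∈Rest)) (≤-refl {2}))

  -- If u is given the role `chosen`, the network serves v, so u is the only vertex needed beyond
  -- the m interior ones.
  minimum-through : ∀ {u v m} → u ~ v → Net u v (Rest u v) m → ∃[ A ] (IndDom G A × ∣ A ∣ ≡ suc m × u ∈ A)
  minimum-through {u} {v} {m} u~v N = A , (independent′ , dominating′) , size′ , u∈A
    where
    open Solution (net-solution N chosen) renaming (A to A₀; A⊆S to A₀⊆)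
    A : Subset n
    A = ⁅ u ⁆ ∪ A₀
    u∈A : u ∈ A
    u∈A = x∈p∪q⁺ (inj₁ (x∈⁅x⁆ u))
    size′ : ∣ A ∣ ≡ suc m
    size′ = trans (∣disjoint-∪∣ ⁅ u ⁆ A₀ (λ w∈u w∈ → proj₁ (∈Rest⁻ (A₀⊆ w∈)) (x∈⁅y⁆⇒x≡y u w∈u))) (cong₂ _+_ (∣⁅x⁆∣≡1 u) size)
    A⁻ : ∀ {w} → w ∈ A → w ≡ u ⊎ w ∈ A₀
    A⁻ w∈ = [ inj₁ ∘ x∈⁅y⁆⇒x≡y u , inj₂ ]′ (x∈p∪q⁻ ⁅ u ⁆ A₀ w∈)
    chosen∈ : ∀ {w} → Chosen A₀ u v chosen served w → w ∈ A
    chosen∈ (inj₁ w∈) = x∈p∪q⁺ (inj₂ w∈)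
    chosen∈ (inj₂ (inj₁ (refl , _))) = u∈A
    independent′ : Independent G A
    independent′ a w a∈ w∈ e with A⁻ a∈ | A⁻ w∈
    ... | inj₁ refl | inj₁ refl = ~-irrefl e refl
    ... | inj₂ a∈₀ | inj₂ w∈₀ = independent a∈₀ (inj₁ w∈₀) e
    ... | inj₂ a∈₀ | inj₁ w≡u = independent a∈₀ (inj₂ (inj₁ (w≡u , refl))) e
    ... | inj₁ a≡u | inj₂ w∈₀ = independent w∈₀ (inj₂ (inj₁ (a≡u , refl))) (~-sym e)
    dominating′ : Dominating G A
    dominating′ w with locate u v w
    ... | inj₁ w∈ = [ inj₁ ∘ x∈p∪q⁺ ∘ inj₂ , (λ (y , c , e) → inj₂ (y , chosen∈ c , e)) ]′ (dominating w∈)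
    ... | inj₂ (inj₁ refl) = inj₁ u∈A
    ... | inj₂ (inj₂ refl) = let y , c , e = served-v refl in inj₂ (y , chosen∈ c , e)

-- An admissible pair as terminals of the graph with the ear.

∣++∣ : ∀ {n t} (p : Subset n) (q : Subset t) → ∣ p ++ q ∣ ≡ ∣ p ∣ + ∣ q ∣
∣++∣ [] q = refl
∣++∣ (inside ∷ p) q = cong suc (∣++∣ p q)
∣++∣ (outside ∷ p) q = ∣++∣ p q

module Ear {n : ℕ} (G : SimpleGraph n) (p q : Fin n) (t : ℕ) where

  H : SimpleGraph (n + t)
  H = attachEar G p q t

  extended : Subset n → Subset (n + t)
  extended A = A ++ ∅

  old : Fin n → Fin (n + t)
  old a = a ↑ˡ t

  private
    module G = Extremal G
    module H = Extremal H

  extended⁺ : ∀ {A a} → a ∈ A → old a ∈ extended A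
  extended⁺ {A} {a} a∈ = lookup⇒[]= (old a) (extended A) (trans (lookup-++ˡ A ∅ a) ([]=⇒lookup a∈))

  extended⁻ : ∀ {A a} → old a ∈ extended A → a ∈ A
  extended⁻ {A} {a} a∈ = lookup⇒[]= a A (trans (sym (lookup-++ˡ A ∅ a)) ([]=⇒lookup a∈))

  new∉ : ∀ {A} (j : Fin t) → n ↑ʳ j ∉ extended A
  new∉ {A} j j∈ = ∉⊥ (lookup⇒[]= j ∅ (trans (sym (lookup-++ʳ A ∅ j)) ([]=⇒lookup j∈)))

  data View : Fin (n + t) → Set where
    is-old : ∀ a → View (old a)
    is-new : ∀ j → View (n ↑ʳ j)

  view : ∀ w → View w
  view w with splitAt n w in eq
  ... | inj₁ a = subst View (splitAt⁻¹-↑ˡ eq) (is-old a)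
  ... | inj₂ j = subst View (splitAt⁻¹-↑ʳ eq) (is-new j)

  ∣extended∩∣ : ∀ A B → ∣ extended A ∩ extended B ∣ ≡ ∣ A ∩ B ∣
  ∣extended∩∣ A B = begin
    ∣ (A ++ ∅) ∩ (B ++ ∅) ∣          ≡⟨ cong ∣_∣ (zipWith-++ _ A ∅ B ∅) ⟩
    ∣ (A ∩ B) ++ (∅ ∩ ∅) ∣           ≡⟨ ∣++∣ (A ∩ B) (∅ ∩ ∅ {t}) ⟩
    ∣ A ∩ B ∣ + ∣ ∅ ∩ ∅ {t} ∣        ≡⟨ cong (λ s → ∣ A ∩ B ∣ + ∣ s ∣) (∩-idem (∅ {t})) ⟩
    ∣ A ∩ B ∣ + ∣ ∅ {t} ∣            ≡⟨ cong (λ z → ∣ A ∩ B ∣ + z) (∣⊥∣≡0 t) ⟩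
    ∣ A ∩ B ∣ + 0                    ≡⟨ +-identityʳ _ ⟩
    ∣ A ∩ B ∣                        ∎
    where open ≡-Reasoning

  ∣extended∣ : ∀ A → ∣ extended A ∣ ≡ ∣ A ∣
  ∣extended∣ A = trans (∣++∣ A ∅) (trans (cong (λ z → ∣ A ∣ + z) (∣⊥∣≡0 t)) (+-identityʳ _))

  old-edge : ∀ {a b} → Adj G a b → Adj H (old a) (old b)
  old-edge {a} {b} e with old a ≟ old b
  ... | yes eq = contradiction (↑ˡ-injective t a b eq) (G.~-irrefl e)
  ... | no _ rewrite splitAt-↑ˡ n a t | splitAt-↑ˡ n b t with adj G a b
  ... | true = _

  ear-edge : ∀ {a j} → a ≢ p → a ≢ q → ¬ Adj H (old a) (n ↑ʳ j)
  ear-edge {a} {j} a≢p a≢q e with old a ≟ n ↑ʳ j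
  ear-edge {a} {j} a≢p a≢q e | no _ rewrite splitAt-↑ˡ n a t | splitAt-↑ʳ n t j with a ≟ p | a ≟ q
  ... | yes a≡p | _ = a≢p a≡p
  ... | no _ | yes a≡q = a≢q a≡q

  -- The new vertices are kept out, so the ear becomes the outer link between p and q while the
  -- interior still has 3m vertices.
  interior : Subset (n + t)
  interior = extended (G.Rest p q)

  terminal≢ : p ≢ q → old p ≢ old q
  terminal≢ p≢q eq = p≢q (↑ˡ-injective t p q eq)

  interior-piece : p ≢ q → H.Piece interior (old p) (old q)
  interior-piece p≢q = record
    { u∉ = λ p∈ → proj₁ (G.∈Rest⁻ (extended⁻ p∈)) refl
    ; v∉ = λ q∈ → proj₂ (G.∈Rest⁻ (extended⁻ q∈)) refl
    ; u≢v = terminal≢ p≢q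
    ; boundary = λ {s} {w} s∈ e → boundary′ (view s) (view w) s∈ e }
    where
    boundary′ : ∀ {s w} → View s → View w → s ∈ interior → Adj H s w → w ∈ interior ⊎ w ≡ old p ⊎ w ≡ old q
    boundary′ (is-new j) _ s∈ _ = contradiction s∈ (new∉ j)
    boundary′ (is-old a) (is-new j) s∈ e = let a≢p , a≢q = G.∈Rest⁻ (extended⁻ s∈) in contradiction e (ear-edge a≢p a≢q)
    boundary′ (is-old a) (is-old b) _ _ with G.locate p q b
    ... | inj₁ b∈ = inj₁ (extended⁺ b∈)
    ... | inj₂ (inj₁ refl) = inj₂ (inj₁ refl)
    ... | inj₂ (inj₂ refl) = inj₂ (inj₂ refl)

  t≡0-or-new : t ≡ 0 ⊎ Fin t
  t≡0-or-new = cases t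
    where
    cases : ∀ t → t ≡ 0 ⊎ Fin t
    cases zero = inj₁ refl
    cases (suc _) = inj₂ zero

  chord : p ≢ q → t ≡ 0 → Adj H (old p) (old q)
  chord p≢q t≡0 with old p ≟ old q
  ... | yes eq = contradiction eq (terminal≢ p≢q)
  ... | no _ rewrite splitAt-↑ˡ n p t | splitAt-↑ˡ n q t | cong (_≡ᵇ 0) t≡0 with p ≟ p | q ≟ q
  ... | no p≢p | _ = contradiction refl p≢p
  ... | yes _ | no q≢q = contradiction refl q≢q
  ... | yes _ | yes _ with adj G p q
  ... | true = _
  ... | false = _

  outer-linked : p ≢ q → H.Linked (H.Outer interior (old p) (old q)) (old p) (old q)
  outer-linked p≢q with t≡0-or-new
  ... | inj₁ t≡0 = inj₁ (chord p≢q t≡0)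
  ... | inj₂ j = inj₂ (n ↑ʳ j , H.∈Outer⁺ interior (old p) (old q) (new∉ j) (new≢old p) (new≢old q))
    where
    new≢old : ∀ a → n ↑ʳ j ≢ old a
    new≢old a eq with trans (sym (splitAt-↑ʳ n t j)) (trans (cong (splitAt n) eq) (splitAt-↑ˡ n a t))
    ... | ()

  -- Since 3m equals the number of joints plus a multiple of 3, the chain closes up to one network
  -- of index m. It needs m vertices of A, and p and q come on top. Domination of the interior
  -- carries over because edges of `G` survive in `H`.
  admissible-pair-bound : ∀ {m} → n ≡ 3 * m + 2 → p ≢ q → Nonempty (G.Rest p q) →
    TwoConnected H → Ternary01 H → ∀ A → Dominating G A → p ∈ A → q ∈ A → 2 + m ≤ ∣ A ∣
  admissible-pair-bound {m} n≡ p≢q (r , r∈) 2-conn ternary A dominating p∈ q∈ = begin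
    2 + m                                                  ≡⟨ cong (λ z → 2 + z) m≡ ⟨
    2 + (j + D.m)                                          ≤⟨ +-monoʳ-≤ 2 (H.net-≤ N (extended A) dominates) ⟩
    2 + ∣ extended A ∩ interior ∣                          ≡⟨ cong (λ z → 2 + z) (∣extended∩∣ A (G.Rest p q)) ⟩
    2 + ∣ A ∩ G.Rest p q ∣                                 ≡⟨ cong₂ (λ a b → a + (b + ∣ A ∩ G.Rest p q ∣)) (indicator-∈ p∈) (indicator-∈ q∈) ⟨
    indicator A p + (indicator A q + ∣ A ∩ G.Rest p q ∣)   ≡⟨ G.∣∣-by-rest p≢q A ⟨
    ∣ A ∣                                                  ∎
    where
    open ≤-Reasoning
    module D = H.Decompose.Decomposed (H.Decompose.decompose ternary (two-connected-walks H 2-conn)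
      (interior-piece p≢q) (inj₂ (old r , extended⁺ r∈)) (outer-linked p≢q))
    interior-size : ∣ interior ∣ ≡ 3 * m
    interior-size = trans (∣extended∣ (G.Rest p q)) (G.∣Rest∣ {m = m} p≢q n≡)
    3∣k : 3 ℕ∣.∣ D.k
    3∣k = ℕ∣.∣m+n∣m⇒∣n (subst (3 ℕ∣.∣_) (trans (sym interior-size) (trans (H.chain-size D.chain) (+-comm D.k (3 * D.m))))
      (ℕ∣.m∣m*n m)) (ℕ∣.m∣m*n D.m)
    j = ℕ∣.quotient 3∣k
    N : H.Net (old p) (old q) interior (j + D.m)
    N = H.ser j (ℕ∣._∣_.equality 3∣k) D.chain
    m≡ : j + D.m ≡ m
    m≡ = *-cancelˡ-≡ (j + D.m) m 3 (trans (sym (H.net-size N)) interior-size)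
    dominates : H.Dominates (extended A) interior
    dominates {s} s∈ = from-view (view s) s∈
      where
      from-view : ∀ {s} → View s → s ∈ interior → s ∈ extended A ⊎ ∃[ w ] (w ∈ extended A × Adj H w s)
      from-view (is-new j) s∈ = contradiction s∈ (new∉ j)
      from-view (is-old a) _ = [ inj₁ ∘ extended⁺ , (λ (w , w∈ , e) → inj₂ (old w , extended⁺ w∈ , old-edge e)) ]′ (dominating a)

-- The four claims.

theorem3p2-generic : ∀ {n} (m : ℕ) → n ≡ 3 * m + 2 → (G : SimpleGraph n) → TwoConnected G → Ternary01 G
    → IndDomNumber G (m + 1)
    × (∀ A → MinIndDom G A → ¬ ContainsAdmissiblePair G A)
    × (∀ x k k′ → IndDomNumber G k → IndDomNumber (G ─ x) k′ → k ≤ k′)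
    × (∀ x → ∃[ A ] (MinIndDom G A × x ∈ A))
theorem3p2-generic {n} m n≡ G 2-conn ternary = number , no-admissible-pair , vertex-deletion , through
  where
  open Extremal G
  m+1≡ : m + 1 ≡ suc m
  m+1≡ = +-comm m 1
  x₀ : Fin n
  x₀ = subst Fin (trans (+-comm 2 (3 * m)) (sym n≡)) zero

  minimum : ∀ x → ∃[ A ] (IndDom G A × ∣ A ∣ ≡ suc m × x ∈ A)
  minimum x = let y , x~y = neighbour G 2-conn x in minimum-through x~y (edge-net ternary 2-conn n≡ x~y)

  bound : ∀ x A → (∀ {w} → w ≢ x → w ∈ A ⊎ ∃[ y ] (y ∈ A × y ~ w)) → suc m ≤ ∣ A ∣
  bound x = let y , x~y = neighbour G 2-conn x in lower-bound x~y (edge-net ternary 2-conn n≡ x~y)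

  bound-IndDom : ∀ A → IndDom G A → suc m ≤ ∣ A ∣
  bound-IndDom A (_ , dominating) = bound x₀ A (λ {w} _ → dominating w)

  number : IndDomNumber G (m + 1)
  number = let A , A-ind , size , _ = minimum x₀ in
    (A , A-ind , trans size (sym m+1≡)) , λ B B-ind → subst (_≤ ∣ B ∣) (sym m+1≡) (bound-IndDom B B-ind)

  through : ∀ x → ∃[ A ] (MinIndDom G A × x ∈ A)
  through x = let A , A-ind , size , x∈ = minimum x in
    A , (A-ind , λ B B-ind → subst (_≤ ∣ B ∣) (sym size) (bound-IndDom B B-ind)) , x∈

  vertex-deletion : ∀ x k k′ → IndDomNumber G k → IndDomNumber (G ─ x) k′ → k ≤ k′
  vertex-deletion x k k′ (_ , k-min) ((B , (_ , B-dom) , ∣B∣≡k′) , _) =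
    let A , A-ind , ∣A∣≡ , _ = minimum x₀
        B⁺ , ∣B⁺∣≡ , B⁺-dom = restore-vertex G x B B-dom
    in ≤-trans (subst (k ≤_) ∣A∣≡ (k-min A A-ind)) (subst (suc m ≤_) (trans ∣B⁺∣≡ ∣B∣≡k′) (bound x B⁺ B⁺-dom))

  no-admissible-pair : ∀ A → MinIndDom G A → ¬ ContainsAdmissiblePair G A
  no-admissible-pair A ((independent , dominating) , minimal)
    (p , q , p∈ , q∈ , p≢q , t , _ , H-2-conn , H-ternary) =
    let B , B-ind , ∣B∣≡ , _ = minimum x₀
        r , p~r = neighbour G 2-conn p
        -- p and q both lie in the independent set A, so the neighbour r of p is not q and the
        -- interior is nonempty.
        r∈Rest = ∈Rest⁺ (≢-sym (~-irrefl p~r)) (λ { refl → independent p q p∈ q∈ p~r })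
    in 1+n≰n (≤-trans (Ear.admissible-pair-bound G p q t n≡ p≢q (r , r∈Rest) H-2-conn H-ternary A dominating p∈ q∈)
                      (subst (∣ A ∣ ≤_) ∣B∣≡ (minimal B B-ind)))

theorem3p2 : ∀ (m : ℕ) (G : SimpleGraph (3 * m + 2))
    → TwoConnected G → Ternary01 G
    → IndDomNumber G (m + 1)
    × (∀ A → MinIndDom G A → ¬ ContainsAdmissiblePair G A)
    × (∀ x k k′ → IndDomNumber G k → IndDomNumber (G ─ x) k′ → k ≤ k′)
    × (∀ x → ∃[ A ] (MinIndDom G A × x ∈ A))
theorem3p2 m = theorem3p2-generic m refl
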